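{- Let $c\ge1$ be a constant such that $\epsilon=N^{ -c}$ is an upper bound on the failure probability of SharedBit gossip when executed with shared randomness, i.e. $\Pr_{\hat r\gets\mathcal R}\left(Z(n,\ell,\mathcal G,A,\hat r)=1\right)\le\epsilon$ for all $n\in[2,N]$, $\ell\in[1,t_{BC}]$, $\mathcal G\in\mathbb G(n)$, $A\in\mathcal A(n)$. Then there exists a multiset $\mathcal R'$ of size $N^{\Theta(1)}$ containing values from $\mathcal R$, such that for every $n\in[2,N]$, $\ell\in[1,t_{BC}]$, $\mathcal G\in\mathbb G(n)$ and $A\in\mathcal A(n)$, $$\Pr_{\hat r\gets\mathcal R'}\left(Z(n,\ell,\mathcal G,A,\hat r)=1\right)<2\epsilon .$$
   Context: Let $N\ge2$ be an integer, $t_{SB}=c_0N^2$ for a constant integer $c_0\ge1$, $t_b=\lceil\log N\rceil+1$, $t_{BC}$ a positive integer with $t_{BC}=O(N^2\,\mathrm{polylog}(N))$, $t_{SSB}=t_{SB}+t_{BC}$, and $\mathcal R=\{0,1\}^{t_{SSB}\cdot N\cdot t_b}$. A string $\hat r\in\mathcal R$ is partitioned into $t_{SSB}$ groups labelled $1,2,\dots$, each consisting of $N$ bundles labelled $1,\dots,N$, each of $t_b$ bits. $\hat r\gets\mathcal R$ (resp. $\hat r\gets\mathcal R'$) means $\hat r$ is chosen uniformly at random from the set (resp. multiset, with multiplicity); the probabilities are over this choice and over the remaining randomness of the execution (the receivers' uniform choices among incoming proposals). "Size $N^{\Theta(1)}$" means the size is bounded above and below by $N$ to fixed positive constant powers independent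 of $N$. $\mathbb G(n)$ is the set of all $t_{SB}$-round dynamic graphs on $n$ nodes, i.e. sequences of $t_{SB}$ connected undirected graphs on the node set $[n]=\{1,\dots,n\}$. $\mathcal A(n)$ is the set of token assignments, i.e. functions $A:[n]\to2^{[n]}$, where $A(u)$ is the set of tokens node $u$ currently knows; tokens in the system are those in $\bigcup_uA(u)$. SharedBit run. Given $n,\ell,\mathcal G,A,\hat r$, run SharedBit for $t_{SB}$ rounds on $\mathcal G$ with initial token sets $A(u)$, where the $s$-th round ($1\le s\le t_{SB}$) uses group $g=\ell+s-1$ of $\hat r$, as follows. For each token $t$ known to $u$ let $t.\mathrm{bit}$ be the first bit of bundle $t$ of group $g$; node $u$ advertises to its current neighbors the sum modulo 2 of $t.\mathrm{bit}$ over the tokens it knows ($0$ if it knows none). A node $u$ advertising $1$ with at least one neighbor advertising $0$ chooses one such neighbor by a fixed rule from the remaining $\lceil\log N\rceil$ bits of bundle $u$ of group $g$ (intended as a uniform choice) and sends it a connection proposal. A node advertising $0$ that receives at least one proposal accepts one uniformly at random, and is connected with its sender for the round. When $u,v$ with different token sets connect, the smallest token in the symmetric difference of their token sets is passed to the node lacking it (i.e. the token transfer subroutine is assumed always to work correctly). $Z(n,\ell,\mathcal G,A,\hat r)$ is the random indicator variable equal to $0$ if this run solves gossip (after the $t_{SB}$ rounds every node knows every token in $\bigcup_uA(u)$) and equal to $1$ otherwise. -}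

module Defs where

open import Algebra.Definitions.RawMonoid using (sum)
open import Algebra.Definitions.RawSemiring using () renaming (_^_ to pow)
open import Data.Bool using (Bool; true; false; if_then_else_; _xor_)
open import Data.Fin using (Fin; zero; suc; fromℕ<; combine; inject≤)
open import Data.Fin.Properties using (_≟_; toℕ<n; toℕ≤n)
open import Data.Fin.Subset using (Subset; _∈_; _∪_; _─_; ⋃; ⁅_⁆; Nonempty)
open import Data.Fin.Subset.Properties using (_∈?_; _⊆?_; nonempty?)
open import Data.Integer using (ℤ; +_; -[1+_])
open import Data.List as List using (List; []; _∷_)
open import Data.List.NonEmpty as List⁺ using (List⁺; _∷_; _⁺++⁺_)
open import Data.Maybe using (Maybe; just; nothing)
import Data.Maybe.Properties as Maybe
open import Data.Nat as ℕ using (ℕ; zero; suc; _+_; _*_; _^_; _≤_; _≡ᵇ_; NonTrivial; nonTrivial⇒nonZero)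
open import Data.Nat.Logarithm using (⌈log₂_⌉)
open import Data.Nat.Properties using (+-mono-<-≤; m^n≢0)
open import Data.Product using (Σ-syntax; ∃-syntax; _×_; proj₁)
open import Data.Rational as ℚ using (ℚ; 0ℚ; 1ℚ; ½; ↥_; ↧ₙ_)
open import Data.Sum using (_⊎_)
open import Data.Vec as Vec using (Vec; []; _∷_; lookup; tabulate; _[_]%=_)
import Data.Vec.Relation.Unary.All as All
open import Relation.Binary.Construct.Closure.ReflexiveTransitive using (Star)
open import Relation.Nullary using (¬_; yes; no; does)

-- Real numbers, as Dedekind cuts of ℚ: Lower q means q < x, and Upper q
-- means x < q.  The operations below act on the underlying cuts.

record Cut : Set₁ where
  field
    Lower : ℚ → Set
    Upper : ℚ → Set

open Cut public

record IsReal (x : Cut) : Set where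
  field
    lower-inhabited : ∃[ q ] Lower x q
    upper-inhabited : ∃[ q ] Upper x q
    lower-closed    : ∀ {q r} → q ℚ.< r → Lower x r → Lower x q
    upper-closed    : ∀ {q r} → q ℚ.< r → Upper x q → Upper x r
    lower-open      : ∀ {q} → Lower x q → ∃[ r ] (q ℚ.< r × Lower x r)
    upper-open      : ∀ {r} → Upper x r → ∃[ q ] (q ℚ.< r × Upper x q)
    disjoint        : ∀ {q} → Lower x q → ¬ Upper x q
    located         : ∀ {q r} → q ℚ.< r → Lower x q ⊎ Upper x r

infix 4 _ℚ<_ _ℚ≤_ _≤ℚ_

_ℚ<_ _ℚ≤_ : ℚ → Cut → Set
q ℚ< x = Lower x q
q ℚ≤ x = ¬ Upper x q

_≤ℚ_ : Cut → ℚ → Set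
x ≤ℚ q = ¬ Lower x q

neg : Cut → Cut
neg x = record { Lower = λ q → Upper x (ℚ.- q) ; Upper = λ q → Lower x (ℚ.- q) }

twice : Cut → Cut
twice x = record { Lower = λ q → Lower x (½ ℚ.* q) ; Upper = λ q → Upper x (½ ℚ.* q) }

ℕ⇒ℚ : ℕ → ℚ
ℕ⇒ℚ n = + n ℚ./ 1

infixr 8 _^ℚ_ _^ℤ_
_^ℚ_ : ℚ → ℕ → ℚ
_^ℚ_ = pow ℚ.+-*-rawSemiring

_^ℤ_ : (N : ℕ) → .{{NonTrivial N}} → ℤ → ℚ
N ^ℤ (+ k)    = ℕ⇒ℚ (N ^ k)
N ^ℤ -[1+ k ] = (+ 1 ℚ./ N ^ suc k) {{m^n≢0 N (suc k) {{nonTrivial⇒nonZero N}}}}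

-- For rational p and q ≥ 0, q < N^p iff q^(↧ p) < N^(↥ p), the denominator
-- ↧ p being positive; the maximum with 0 accounts for q < 0.  For real x and
-- N ≥ 2, q < N^x iff q < N^p for some rational p < x, and N^x < q iff
-- N^p < q for some rational p > x.
infixr 8 _^ʳ_
_^ʳ_ : (N : ℕ) → .{{NonTrivial N}} → Cut → Cut
N ^ʳ x = record
  { Lower = λ q → ∃[ p ] (Lower x p × ((0ℚ ℚ.⊔ q) ^ℚ ↧ₙ p) ℚ.< (N ^ℤ (↥ p)))
  ; Upper = λ q → ∃[ p ] (Upper x p × (N ^ℤ (↥ p)) ℚ.< ((0ℚ ℚ.⊔ q) ^ℚ ↧ₙ p))
  }

-- t(N) = O(N² polylog N)
QuadraticPolylog : (ℕ → ℕ) → Set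
QuadraticPolylog t =
  ∃[ K ] ∃[ k ] ∃[ N₀ ] (∀ N → N₀ ≤ N → t N ≤ K * N ^ 2 * ⌈log₂ N ⌉ ^ k)

-- Finite random processes: each `choose` is a uniform choice among its suc k
-- branches, independent of all earlier choices.

data Prob (A : Set) : Set where
  return : A → Prob A
  choose : ∀ {k} → (Fin (suc k) → Prob A) → Prob A

infixl 1 _>>=_
_>>=_ : ∀ {A B} → Prob A → (A → Prob B) → Prob B
return a >>= f = f a
choose b >>= f = choose λ i → b i >>= f

foldM : ∀ {A B : Set} → (B → A → Prob B) → B → List A → Prob B
foldM f b []       = return b
foldM f b (a ∷ as) = f b a >>= λ b′ → foldM f b′ as

-- Uniform over the positions of the list, hence with multiplicity.
uniform : ∀ {A} → List⁺ A → Prob A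
uniform (a ∷ as) = choose λ i → return (List.lookup (a ∷ as) i)

Pr : ∀ {A} → Prob A → (A → Bool) → ℚ
Pr (return a)     E = if E a then 1ℚ else 0ℚ
Pr (choose {k} b) E = (+ 1 ℚ./ suc k) ℚ.* sum ℚ.+-0-rawMonoid (λ i → Pr (b i) E)

allStrings : ∀ m → List⁺ (Vec Bool m)
allStrings zero    = List⁺.[ [] ]
allStrings (suc m) =
  List⁺.map (false ∷_) (allStrings m) ⁺++⁺ List⁺.map (true ∷_) (allStrings m)

-- Nodes, tokens, groups, bundles and rounds are numbered from 0 (via Fin)
-- instead of from 1.

record Graph (n : ℕ) : Set where
  field
    neighbors : Vec (Subset n) n

  Adjacent : Fin n → Fin n → Set
  Adjacent u v = v ∈ lookup neighbors u

  field
    symmetric : ∀ u v → Adjacent u v → Adjacent v u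
    loopless  : ∀ u → ¬ Adjacent u u
    connected : ∀ u v → Star Adjacent u v

open Graph public using (neighbors)

Assignment : ℕ → Set
Assignment n = Vec (Subset n) n

-- In increasing order.
elements : ∀ {n} → Subset n → List (Fin n)
elements {n} S = List.filter (_∈? S) (List.allFin n)

-- How a node picks the recipient of its proposal, from the nonempty set of its
-- neighbors advertising 0 and the bits of its bundle after the first.
ProposalRule : ℕ → Set
ProposalRule N =
  ∀ {n} → Fin n → (S : Subset n) → .(Nonempty S) → Vec Bool ⌈log₂ N ⌉ → Σ[ v ∈ Fin n ] v ∈ S

transfer : ∀ {n} → Fin n → Fin n → Assignment n → Assignment n
transfer u v A with elements ((lookup A u ─ lookup A v) ∪ (lookup A v ─ lookup A u))
... | []    = A
... | t ∷ _ = A [ u ]%= (_∪ ⁅ t ⁆) [ v ]%= (_∪ ⁅ t ⁆)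

module SharedBit (N c₀ tBC : ℕ) (rule : ProposalRule N) where

  tSB tb tSSB : ℕ
  tSB  = c₀ * N ^ 2
  tb   = suc ⌈log₂ N ⌉
  tSSB = tSB + tBC

  𝓡 : Set
  𝓡 = Vec Bool (tSSB * N * tb)

  all𝓡 : List⁺ 𝓡
  all𝓡 = allStrings (tSSB * N * tb)

  bit : 𝓡 → Fin tSSB → Fin N → Fin tb → Bool
  bit r̂ g i k = lookup r̂ (combine (combine g i) k)

  DynamicGraph : ℕ → Set
  DynamicGraph n = Vec (Graph n) tSB

  module _ {n : ℕ} (n≤N : n ≤ N) (r̂ : 𝓡) where

    bundle : Fin n → Fin N
    bundle i = inject≤ i n≤N

    module _ (G : Graph n) (g : Fin tSSB) (A : Assignment n) where

      advertised : Fin n → Bool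
      advertised u =
        List.foldr _xor_ false
          (List.map (λ t → bit r̂ g (bundle t) zero) (elements (lookup A u)))

      candidates : Fin n → Subset n
      candidates u =
        tabulate λ v →
          if advertised v then false else lookup (lookup (neighbors G) u) v

      proposal : Fin n → Maybe (Fin n)
      proposal u with advertised u | nonempty? (candidates u)
      ... | true | yes ne =
        just (proj₁ (rule u (candidates u) ne (tabulate λ k → bit r̂ g (bundle u) (suc k))))
      ... | _    | _      = nothing

      proposers : Fin n → List (Fin n)
      proposers v =
        List.filter (λ u → Maybe.≡-dec _≟_ (proposal u) (just v)) (List.allFin n)

      accept : Assignment n → Fin n → Prob (Assignment n)
      accept B v with proposers v
      ... | []     = return B
      ... | u ∷ us = uniform (u ∷ us) >>= λ w → return (transfer w v B)

      -- Proposals depend only on A, the state at the start of the round.  A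
      -- proposer advertises 1 and makes a single proposal, and a recipient
      -- advertises 0 and accepts a single one, so the connections form a
      -- matching and the transfers can be performed one after another.
      round : Prob (Assignment n)
      round = foldM accept A (List.allFin n)

    -- Zero-based, the label ℓ + s - 1 becomes the sum of the two indices.
    group : Fin tBC → Fin tSB → Fin tSSB
    group ℓ s = fromℕ< (+-mono-<-≤ (toℕ<n s) (toℕ≤n ℓ))

    run : Fin tBC → DynamicGraph n → Assignment n → Prob (Assignment n)
    run ℓ 𝒢 A = foldM (λ B s → round (lookup 𝒢 s) (group ℓ s) B) A (List.allFin tSB)

  solved : ∀ {n} → Assignment n → Assignment n → Bool
  solved A B = does (All.all? (⋃ (Vec.toList A) ⊆?_) B)

  Z : ∀ n → n ≤ N → Fin tBC → DynamicGraph n → Assignment n → 𝓡 → Prob ℕ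
  Z n n≤N ℓ 𝒢 A r̂ = run n≤N r̂ ℓ 𝒢 A >>= λ B → return (if solved A B then 0 else 1)

  -- The probability that Z = 1 when r̂ is drawn uniformly from the multiset R.
  Pr[Z≡1] : List⁺ 𝓡 → ∀ n → n ≤ N → Fin tBC → DynamicGraph n → Assignment n → ℚ
  Pr[Z≡1] R n n≤N ℓ 𝒢 A = Pr (uniform R >>= Z n n≤N ℓ 𝒢 A) (_≡ᵇ 1)

{-# OPTIONS --safe #-}
-- A run depends on the graphs only through their adjacency sets, so there are fewer
-- than 2^E inputs (n, ℓ, 𝒢, A) to consider, with E polynomial in N.  If ν bounds the
-- failure probability of each of them, a sample of polynomially many strings on which
-- every average failure probability is at most 3/2 ν is found greedily, keeping the
-- exponential-moment potential of the Chernoff bound below its expectation.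
-- It remains to find ν with 3/2 ν < 2 N^(-c).  Approximating the real c closely shows
-- that every rational q ≥ 0 satisfies N^(-c) < q or ⅞ q < N^(-c); stepping through a
-- grid of width N^(-C)/6 with C > c then yields ν with ¾ ν < N^(-c) such that no
-- probability at most N^(-c) exceeds ν.
module Submission where

open import Defs
open import Data.Fin using (Fin)
open import Data.List.NonEmpty using (List⁺; length)
open import Data.Nat using (ℕ; _≤_; _<_; NonTrivial)
open import Data.Product using (∃-syntax; _×_)
open import Data.Rational using (0ℚ; 1ℚ)

open import Algebra.Bundles using (CommutativeRing)
open import Algebra.Definitions.RawMonoid using (sum)
open import Data.Bool using (Bool; true; false; if_then_else_; _xor_)
open import Data.Fin using (zero; suc; fromℕ<; toℕ)
import Data.Fin.Properties as Fin
open import Data.Fin.Subset using (Subset; Nonempty)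
open import Data.Fin.Subset.Properties using (nonempty?)
open import Data.Integer using (+_; -[1+_])
import Data.Integer as ℤ
import Data.Integer.Properties as ℤ
open import Data.List as List using (List; []; _∷_; cartesianProductWith; cartesianProduct; concatMap; allFin)
open import Data.List.Membership.Propositional using (_∈_; lose)
import Data.List.Membership.Propositional.Properties as List
import Data.List.Properties as List
open import Data.List.NonEmpty as List⁺ using (_∷_)
open import Data.List.Relation.Unary.Any using (here; there)
open import Data.Maybe using (Maybe; just; nothing)
import Data.Maybe.Properties as Maybe
open import Data.Nat using (zero; suc; z≤n; s≤s; _≡ᵇ_; nonTrivial⇒nonZero; nonTrivial⇒n>1)
import Data.Nat as ℕ
open import Data.Nat.Logarithm using (⌈log₂_⌉; ⌈log₂⌉-mono-≤; ⌈log₂2^n⌉≡n)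
import Data.Nat.Properties as ℕ
open import Data.Nat.Tactic.RingSolver using (solve-∀)
open import Data.Product using (Σ-syntax; _,_; proj₁; proj₂)
open import Data.Rational using (ℚ; ½; ↥_; ↧ₙ_; mkℚ)
import Data.Rational as ℚ
import Data.Rational.Properties as ℚ
open import Data.Rational.Solver using (module +-*-Solver)
import Data.Rational.Unnormalised as ℚᵘ
import Data.Rational.Unnormalised.Properties as ℚᵘ
open import Data.Sum using (_⊎_; inj₁; inj₂; [_,_]′)
open import Data.Vec as Vec using (Vec; []; _∷_; lookup; tabulate)
import Data.Vec.Properties as Vec
open import Function using (_∘_; id)
open import Relation.Binary.PropositionalEquality
open import Relation.Nullary using (Dec; ¬_; yes; no; contradiction)
open import Relation.Nullary.Decidable using (from-yes)
open import Algebra.Properties.CommutativeSemiring.Exp (CommutativeRing.commutativeSemiring ℚ.+-*-commutativeRing)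
  using (^-distrib-*)
open import Algebra.Properties.Monoid.Sum ℚ.+-0-monoid using (sum-cong-≗)
open import Algebra.Properties.Semiring.Exp (CommutativeRing.semiring ℚ.+-*-commutativeRing)
  using (^-assocʳ)
open +-*-Solver

-- Ordered arithmetic in ℚ

-- The exponent `c` is a Dedekind cut, so the order of `N^(-c)` against rationals is not decidable,
-- whereas every failure probability of a run is rational. All counting is therefore done against
-- one rational `ν`, and the gap between 3/2 and 2 pays for the replacement: `¾ ν < N^(-c)` is
-- exactly `3/2 ν < 2 N^(-c)`. Keeping `ν` in the form `k / L` makes both the sample size and the
-- failure threshold integers, so nothing is rounded. The receivers' choices stay random once a
-- string is fixed. A string thus fails on an input with some probability in [0,1], not with a mere
-- yes or no, and the moment bound must cope with fractional values. Factors `1 + x/4` take the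
-- place of exponentials to remain in ℚ; the greedy choice yields an explicit sample and spares a
-- product probability space. The inputs that are enumerated include adjacency data of no connected
-- graph, about which the hypothesis is silent. The sample is asked to be good only where the mean
-- failure is at most `ν`, which is decidable; the hypothesis serves solely to place every genuine
-- input among these.

0≤+ : ∀ {p q} → 0ℚ ℚ.≤ p → 0ℚ ℚ.≤ q → 0ℚ ℚ.≤ p ℚ.+ q
0≤+ = ℚ.+-mono-≤

0≤* : ∀ {p q} → 0ℚ ℚ.≤ p → 0ℚ ℚ.≤ q → 0ℚ ℚ.≤ p ℚ.* q
0≤* {p} {q} 0≤p 0≤q = ℚ.nonNegative⁻¹ _ {{ℚ.nonNeg*nonNeg⇒nonNeg p {{ℚ.nonNegative 0≤p}} q {{ℚ.nonNegative 0≤q}}}}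

0<* : ∀ {p q} → 0ℚ ℚ.< p → 0ℚ ℚ.< q → 0ℚ ℚ.< p ℚ.* q
0<* {p} {q} 0<p 0<q = ℚ.positive⁻¹ _ {{ℚ.pos*pos⇒pos p {{ℚ.positive 0<p}} q {{ℚ.positive 0<q}}}}

*-monoˡ-≤ : ∀ {r p q} → 0ℚ ℚ.≤ r → p ℚ.≤ q → r ℚ.* p ℚ.≤ r ℚ.* q
*-monoˡ-≤ {r} 0≤r = ℚ.*-monoˡ-≤-nonNeg r {{ℚ.nonNegative 0≤r}}

*-monoʳ-≤ : ∀ {r p q} → 0ℚ ℚ.≤ r → p ℚ.≤ q → p ℚ.* r ℚ.≤ q ℚ.* r
*-monoʳ-≤ {r} 0≤r = ℚ.*-monoʳ-≤-nonNeg r {{ℚ.nonNegative 0≤r}}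

*-mono-≤ : ∀ {p s q r} → 0ℚ ℚ.≤ p → 0ℚ ℚ.≤ s → p ℚ.≤ q → r ℚ.≤ s → p ℚ.* r ℚ.≤ q ℚ.* s
*-mono-≤ 0≤p 0≤s p≤q r≤s = ℚ.≤-trans (*-monoˡ-≤ 0≤p r≤s) (*-monoʳ-≤ 0≤s p≤q)

*-monoʳ-< : ∀ {r p q} → 0ℚ ℚ.< r → p ℚ.< q → p ℚ.* r ℚ.< q ℚ.* r
*-monoʳ-< {r} 0<r = ℚ.*-monoˡ-<-pos r {{ℚ.positive 0<r}}

*-cancelʳ-< : ∀ {r p q} → 0ℚ ℚ.≤ r → p ℚ.* r ℚ.< q ℚ.* r → p ℚ.< q
*-cancelʳ-< {r} 0≤r = ℚ.*-cancelʳ-<-nonNeg r {{ℚ.nonNegative 0≤r}}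

*-cancelʳ-≤ : ∀ {r p q} → 0ℚ ℚ.< r → p ℚ.* r ℚ.≤ q ℚ.* r → p ℚ.≤ q
*-cancelʳ-≤ {r} 0<r = ℚ.*-cancelʳ-≤-pos r {{ℚ.positive 0<r}}

≤-by-difference : ∀ {p q} d → p ℚ.+ d ≡ q → 0ℚ ℚ.≤ d → p ℚ.≤ q
≤-by-difference {p} d refl 0≤d = ℚ.≤-trans (ℚ.≤-reflexive (sym (ℚ.+-identityʳ p))) (ℚ.+-monoʳ-≤ p 0≤d)

0≤q-p : ∀ {p q} → p ℚ.≤ q → 0ℚ ℚ.≤ q ℚ.- p
0≤q-p {p} p≤q = ℚ.≤-trans (ℚ.≤-reflexive (sym (ℚ.+-inverseʳ p))) (ℚ.+-monoˡ-≤ (ℚ.- p) p≤q)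

0≤1 : 0ℚ ℚ.≤ 1ℚ
0≤1 = ℚ.nonNegative⁻¹ 1ℚ

0<1 : 0ℚ ℚ.< 1ℚ
0<1 = ℚ.positive⁻¹ 1ℚ

^-nonNeg : ∀ {x} n → 0ℚ ℚ.≤ x → 0ℚ ℚ.≤ x ^ℚ n
^-nonNeg zero    0≤x = 0≤1
^-nonNeg (suc n) 0≤x = 0≤* 0≤x (^-nonNeg n 0≤x)

^-pos : ∀ {x} n → 0ℚ ℚ.< x → 0ℚ ℚ.< x ^ℚ n
^-pos zero    0<x = 0<1
^-pos (suc n) 0<x = 0<* 0<x (^-pos n 0<x)

^-monoˡ-≤ : ∀ {x y} n → 0ℚ ℚ.≤ x → x ℚ.≤ y → x ^ℚ n ℚ.≤ y ^ℚ n
^-monoˡ-≤ zero    0≤x x≤y = ℚ.≤-refl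
^-monoˡ-≤ (suc n) 0≤x x≤y =
  *-mono-≤ 0≤x (^-nonNeg n (ℚ.≤-trans 0≤x x≤y)) x≤y (^-monoˡ-≤ n 0≤x x≤y)

^-monoˡ-< : ∀ {x y} n → 0ℚ ℚ.≤ x → x ℚ.< y → x ^ℚ suc n ℚ.< y ^ℚ suc n
^-monoˡ-< n 0≤x x<y = ℚ.≤-<-trans
  (*-monoˡ-≤ 0≤x (^-monoˡ-≤ n 0≤x (ℚ.<⇒≤ x<y)))
  (*-monoʳ-< (^-pos n (ℚ.≤-<-trans 0≤x x<y)) x<y)

^-cancelˡ-< : ∀ {y x} n → 0ℚ ℚ.≤ y → x ^ℚ n ℚ.< y ^ℚ n → x ℚ.< y
^-cancelˡ-< {y} {x} n 0≤y xⁿ<yⁿ with x ℚ.<? y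
... | yes x<y = x<y
... | no  x≮y = contradiction (ℚ.<-≤-trans xⁿ<yⁿ (^-monoˡ-≤ n 0≤y (ℚ.≮⇒≥ x≮y))) (ℚ.<-irrefl refl)

1^n≡1 : ∀ n → 1ℚ ^ℚ n ≡ 1ℚ
1^n≡1 zero    = refl
1^n≡1 (suc n) = trans (ℚ.*-identityˡ _) (1^n≡1 n)

^-≤1 : ∀ {x} n → 0ℚ ℚ.≤ x → x ℚ.≤ 1ℚ → x ^ℚ n ℚ.≤ 1ℚ
^-≤1 n 0≤x x≤1 = ℚ.≤-trans (^-monoˡ-≤ n 0≤x x≤1) (ℚ.≤-reflexive (1^n≡1 n))

^-≥1 : ∀ {x} n → 1ℚ ℚ.≤ x → 1ℚ ℚ.≤ x ^ℚ n
^-≥1 n 1≤x = ℚ.≤-trans (ℚ.≤-reflexive (sym (1^n≡1 n))) (^-monoˡ-≤ n 0≤1 1≤x)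

^-monoʳ-≤ : ∀ {x} {m n} → 1ℚ ℚ.≤ x → m ≤ n → x ^ℚ m ℚ.≤ x ^ℚ n
^-monoʳ-≤ {x} {n = n} 1≤x z≤n       = ^-≥1 n 1≤x
^-monoʳ-≤ {x}         1≤x (s≤s m≤n) = *-monoˡ-≤ (ℚ.≤-trans 0≤1 1≤x) (^-monoʳ-≤ 1≤x m≤n)

toℚᵘ-ℕ⇒ℚ : ∀ n → ℚ.toℚᵘ (ℕ⇒ℚ n) ℚᵘ.≃ ℚᵘ.mkℚᵘ (+ n) 0
toℚᵘ-ℕ⇒ℚ n = ℚ.toℚᵘ-fromℚᵘ (ℚᵘ.mkℚᵘ (+ n) 0)

ℕ⇒ℚ-+ : ∀ m n → ℕ⇒ℚ (m ℕ.+ n) ≡ ℕ⇒ℚ m ℚ.+ ℕ⇒ℚ n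
ℕ⇒ℚ-+ m n = ℚ.toℚᵘ-injective (begin
  ℚ.toℚᵘ (ℕ⇒ℚ (m ℕ.+ n))                        ≈⟨ toℚᵘ-ℕ⇒ℚ (m ℕ.+ n) ⟩
  ℚᵘ.mkℚᵘ (+ (m ℕ.+ n)) 0                        ≈⟨ ℚᵘ.*≡* (cong (ℤ._* + 1) (sym (cong₂ ℤ._+_ (ℤ.*-identityʳ (+ m)) (ℤ.*-identityʳ (+ n))))) ⟩
  ℚᵘ.mkℚᵘ (+ m) 0 ℚᵘ.+ ℚᵘ.mkℚᵘ (+ n) 0           ≈⟨ ℚᵘ.+-cong (toℚᵘ-ℕ⇒ℚ m) (toℚᵘ-ℕ⇒ℚ n) ⟨
  ℚ.toℚᵘ (ℕ⇒ℚ m) ℚᵘ.+ ℚ.toℚᵘ (ℕ⇒ℚ n)           ≈⟨ ℚ.toℚᵘ-homo-+ (ℕ⇒ℚ m) (ℕ⇒ℚ n) ⟨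
  ℚ.toℚᵘ (ℕ⇒ℚ m ℚ.+ ℕ⇒ℚ n)                      ∎)
  where open ℚᵘ.≃-Reasoning

[j/g]*g≡j : ∀ j g → .{{_ : ℕ.NonZero g}} → (+ j ℚ./ g) ℚ.* ℕ⇒ℚ g ≡ ℕ⇒ℚ j
[j/g]*g≡j j g@(suc g-1) = ℚ.toℚᵘ-injective (begin
  ℚ.toℚᵘ ((+ j ℚ./ g) ℚ.* ℕ⇒ℚ g)                ≈⟨ ℚ.toℚᵘ-homo-* (+ j ℚ./ g) (ℕ⇒ℚ g) ⟩
  ℚ.toℚᵘ (+ j ℚ./ g) ℚᵘ.* ℚ.toℚᵘ (ℕ⇒ℚ g)       ≈⟨ ℚᵘ.*-cong (ℚ.toℚᵘ-fromℚᵘ (ℚᵘ.mkℚᵘ (+ j) g-1)) (toℚᵘ-ℕ⇒ℚ g) ⟩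
  ℚᵘ.mkℚᵘ (+ j) g-1 ℚᵘ.* ℚᵘ.mkℚᵘ (+ g) 0         ≈⟨ ℚᵘ.*≡* (trans (ℤ.*-identityʳ _) (cong (+ j ℤ.*_) (cong +_ (sym (ℕ.*-identityʳ g))))) ⟩
  ℚᵘ.mkℚᵘ (+ j) 0                                ≈⟨ toℚᵘ-ℕ⇒ℚ j ⟨
  ℚ.toℚᵘ (ℕ⇒ℚ j)                                 ∎)
  where open ℚᵘ.≃-Reasoning

ℕ⇒ℚ-nonNeg : ∀ n → 0ℚ ℚ.≤ ℕ⇒ℚ n
ℕ⇒ℚ-nonNeg n = ℚ.nonNegative⁻¹ _ {{ℚ.normalize-nonNeg n 1}}

ℕ⇒ℚ-suc : ∀ n → ℕ⇒ℚ (suc n) ≡ 1ℚ ℚ.+ ℕ⇒ℚ n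
ℕ⇒ℚ-suc = ℕ⇒ℚ-+ 1

ℕ⇒ℚ-* : ∀ m n → ℕ⇒ℚ (m ℕ.* n) ≡ ℕ⇒ℚ m ℚ.* ℕ⇒ℚ n
ℕ⇒ℚ-* zero    n = sym (ℚ.*-zeroˡ (ℕ⇒ℚ n))
ℕ⇒ℚ-* (suc m) n = begin
  ℕ⇒ℚ (n ℕ.+ m ℕ.* n)              ≡⟨ ℕ⇒ℚ-+ n (m ℕ.* n) ⟩
  ℕ⇒ℚ n ℚ.+ ℕ⇒ℚ (m ℕ.* n)          ≡⟨ cong (ℕ⇒ℚ n ℚ.+_) (ℕ⇒ℚ-* m n) ⟩
  ℕ⇒ℚ n ℚ.+ ℕ⇒ℚ m ℚ.* ℕ⇒ℚ n        ≡⟨ solve 2 (λ n m → n :+ m :* n := (con 1ℚ :+ m) :* n) refl (ℕ⇒ℚ n) (ℕ⇒ℚ m) ⟩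
  (1ℚ ℚ.+ ℕ⇒ℚ m) ℚ.* ℕ⇒ℚ n         ≡⟨ cong (ℚ._* ℕ⇒ℚ n) (ℕ⇒ℚ-suc m) ⟨
  ℕ⇒ℚ (suc m) ℚ.* ℕ⇒ℚ n            ∎
  where open ≡-Reasoning

ℕ⇒ℚ-^ : ∀ m n → ℕ⇒ℚ (m ℕ.^ n) ≡ ℕ⇒ℚ m ^ℚ n
ℕ⇒ℚ-^ m zero    = refl
ℕ⇒ℚ-^ m (suc n) = trans (ℕ⇒ℚ-* m (m ℕ.^ n)) (cong (ℕ⇒ℚ m ℚ.*_) (ℕ⇒ℚ-^ m n))

ℕ⇒ℚ-mono-≤ : ∀ {m n} → m ≤ n → ℕ⇒ℚ m ℚ.≤ ℕ⇒ℚ n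
ℕ⇒ℚ-mono-≤ {m} {n} m≤n = ≤-by-difference (ℕ⇒ℚ (n ℕ.∸ m))
  (trans (sym (ℕ⇒ℚ-+ m (n ℕ.∸ m))) (cong ℕ⇒ℚ (ℕ.m+[n∸m]≡n m≤n))) (ℕ⇒ℚ-nonNeg (n ℕ.∸ m))

n<1+n : ∀ n → ℕ⇒ℚ n ℚ.< ℕ⇒ℚ (suc n)
n<1+n n = subst₂ ℚ._<_ (ℚ.+-identityˡ (ℕ⇒ℚ n)) (sym (ℕ⇒ℚ-suc n)) (ℚ.+-monoˡ-< (ℕ⇒ℚ n) 0<1)

ℕ⇒ℚ-mono-< : ∀ {m n} → m < n → ℕ⇒ℚ m ℚ.< ℕ⇒ℚ n
ℕ⇒ℚ-mono-< {m} m<n = ℚ.<-≤-trans (n<1+n m) (ℕ⇒ℚ-mono-≤ m<n)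

ℕ⇒ℚ-cancel-< : ∀ {m n} → ℕ⇒ℚ m ℚ.< ℕ⇒ℚ n → m < n
ℕ⇒ℚ-cancel-< {m} {n} m<n with m ℕ.<? n
... | yes m<n = m<n
... | no  m≮n = contradiction (ℚ.<-≤-trans m<n (ℕ⇒ℚ-mono-≤ (ℕ.≮⇒≥ m≮n))) (ℚ.<-irrefl refl)

ℕ⇒ℚ-cancel-≤ : ∀ {m n} → ℕ⇒ℚ m ℚ.≤ ℕ⇒ℚ n → m ≤ n
ℕ⇒ℚ-cancel-≤ {m} {n} m≤n with m ℕ.≤? n
... | yes m≤n = m≤n
... | no  m≰n = contradiction (ℚ.≤-<-trans m≤n (ℕ⇒ℚ-mono-< (ℕ.≰⇒> m≰n))) (ℚ.<-irrefl refl)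

ℕ⇒ℚ-injective : ∀ {m n} → ℕ⇒ℚ m ≡ ℕ⇒ℚ n → m ≡ n
ℕ⇒ℚ-injective m≡n = ℕ.≤-antisym (ℕ⇒ℚ-cancel-≤ (ℚ.≤-reflexive m≡n)) (ℕ⇒ℚ-cancel-≤ (ℚ.≤-reflexive (sym m≡n)))

bernoulli : ∀ {y} n → 0ℚ ℚ.≤ y → 1ℚ ℚ.+ ℕ⇒ℚ n ℚ.* y ℚ.≤ (1ℚ ℚ.+ y) ^ℚ n
bernoulli {y} zero    0≤y = ℚ.≤-reflexive (solve 1 (λ y → con 1ℚ :+ con 0ℚ :* y := con 1ℚ) refl y)
bernoulli {y} (suc n) 0≤y = ℚ.≤-trans
  (≤-by-difference (n′ ℚ.* (y ℚ.* y))
    (trans (cong (λ m → 1ℚ ℚ.+ m ℚ.* y ℚ.+ n′ ℚ.* (y ℚ.* y)) (ℕ⇒ℚ-suc n))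
      (solve 2 (λ n y → con 1ℚ :+ (con 1ℚ :+ n) :* y :+ n :* (y :* y) := (con 1ℚ :+ y) :* (con 1ℚ :+ n :* y)) refl n′ y))
    (0≤* (ℕ⇒ℚ-nonNeg n) (0≤* 0≤y 0≤y)))
  (*-monoˡ-≤ (0≤+ 0≤1 0≤y) (bernoulli n 0≤y))
  where n′ = ℕ⇒ℚ n

-- In effect (1 + y)ⁿ ≤ 1 / (1 - n y).
bernoulli-reciprocal : ∀ {y} n → 0ℚ ℚ.≤ y → (1ℚ ℚ.+ y) ^ℚ n ℚ.* (1ℚ ℚ.- ℕ⇒ℚ n ℚ.* y) ℚ.≤ 1ℚ
bernoulli-reciprocal {y} zero    0≤y = ℚ.≤-reflexive (solve 1 (λ y → con 1ℚ :* (con 1ℚ :- con 0ℚ :* y) := con 1ℚ) refl y)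
bernoulli-reciprocal {y} (suc n) 0≤y = ℚ.≤-trans
  (≤-by-difference (z ℚ.* ((1ℚ ℚ.+ n′) ℚ.* (y ℚ.* y)))
    (trans (cong (λ m → (1ℚ ℚ.+ y) ℚ.* z ℚ.* (1ℚ ℚ.- m ℚ.* y) ℚ.+ z ℚ.* ((1ℚ ℚ.+ n′) ℚ.* (y ℚ.* y))) (ℕ⇒ℚ-suc n))
      (solve 3 (λ n y z → (con 1ℚ :+ y) :* z :* (con 1ℚ :- (con 1ℚ :+ n) :* y) :+ z :* ((con 1ℚ :+ n) :* (y :* y))
                          := z :* (con 1ℚ :- n :* y)) refl n′ y z))
    (0≤* (^-nonNeg n (0≤+ 0≤1 0≤y)) (0≤* (0≤+ 0≤1 (ℕ⇒ℚ-nonNeg n)) (0≤* 0≤y 0≤y))))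
  (bernoulli-reciprocal n 0≤y)
  where
  n′ = ℕ⇒ℚ n
  z  = (1ℚ ℚ.+ y) ^ℚ n

-- The derandomized Chernoff bound

private variable
  A B I : Set

∑ ∏ : List A → (A → ℚ) → ℚ
∑ []       f = 0ℚ
∑ (x ∷ xs) f = f x ℚ.+ ∑ xs f
∏ []       f = 1ℚ
∏ (x ∷ xs) f = f x ℚ.* ∏ xs f

∑-mono-≤ : ∀ (xs : List A) {f g} → (∀ {x} → x ∈ xs → f x ℚ.≤ g x) → ∑ xs f ℚ.≤ ∑ xs g
∑-mono-≤ []       f≤g = ℚ.≤-refl
∑-mono-≤ (x ∷ xs) f≤g = ℚ.+-mono-≤ (f≤g (here refl)) (∑-mono-≤ xs (f≤g ∘ there))

∑-cong : ∀ (xs : List A) {f g} → (∀ x → f x ≡ g x) → ∑ xs f ≡ ∑ xs g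
∑-cong []       f≡g = refl
∑-cong (x ∷ xs) f≡g = cong₂ ℚ._+_ (f≡g x) (∑-cong xs f≡g)

∑-+ : ∀ (xs : List A) f g → ∑ xs (λ x → f x ℚ.+ g x) ≡ ∑ xs f ℚ.+ ∑ xs g
∑-+ []       f g = refl
∑-+ (x ∷ xs) f g = trans (cong (f x ℚ.+ g x ℚ.+_) (∑-+ xs f g))
  (solve 4 (λ a b c d → a :+ b :+ (c :+ d) := a :+ c :+ (b :+ d)) refl (f x) (g x) (∑ xs f) (∑ xs g))

∑-*ʳ : ∀ (xs : List A) f c → ∑ xs (λ x → f x ℚ.* c) ≡ ∑ xs f ℚ.* c
∑-*ʳ []       f c = sym (ℚ.*-zeroˡ c)
∑-*ʳ (x ∷ xs) f c = trans (cong (f x ℚ.* c ℚ.+_) (∑-*ʳ xs f c)) (sym (ℚ.*-distribʳ-+ c (f x) (∑ xs f)))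

∑-const : ∀ (xs : List A) c → ∑ xs (λ _ → c) ≡ ℕ⇒ℚ (List.length xs) ℚ.* c
∑-const []       c = sym (ℚ.*-zeroˡ c)
∑-const (x ∷ xs) c = begin
  c ℚ.+ ∑ xs (λ _ → c)                  ≡⟨ cong (c ℚ.+_) (∑-const xs c) ⟩
  c ℚ.+ ℕ⇒ℚ (List.length xs) ℚ.* c      ≡⟨ solve 2 (λ c n → c :+ n :* c := (con 1ℚ :+ n) :* c) refl c (ℕ⇒ℚ (List.length xs)) ⟩
  (1ℚ ℚ.+ ℕ⇒ℚ (List.length xs)) ℚ.* c   ≡⟨ cong (ℚ._* c) (ℕ⇒ℚ-suc (List.length xs)) ⟨
  ℕ⇒ℚ (suc (List.length xs)) ℚ.* c      ∎
  where open ≡-Reasoning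

∑-swap : ∀ (xs : List A) (ys : List B) (f : A → B → ℚ) → ∑ xs (λ x → ∑ ys (f x)) ≡ ∑ ys (λ y → ∑ xs (λ x → f x y))
∑-swap []       ys f = sym (trans (∑-const ys 0ℚ) (ℚ.*-zeroʳ (ℕ⇒ℚ (List.length ys))))
∑-swap (x ∷ xs) ys f = trans (cong (∑ ys (f x) ℚ.+_) (∑-swap xs ys f)) (sym (∑-+ ys (f x) (λ y → ∑ xs (λ x → f x y))))

∑-nonNeg : ∀ (xs : List A) f → (∀ x → 0ℚ ℚ.≤ f x) → 0ℚ ℚ.≤ ∑ xs f
∑-nonNeg []       f 0≤f = ℚ.≤-refl
∑-nonNeg (x ∷ xs) f 0≤f = 0≤+ (0≤f x) (∑-nonNeg xs f 0≤f)

term≤∑ : ∀ (xs : List A) f → (∀ x → 0ℚ ℚ.≤ f x) → ∀ {x} → x ∈ xs → f x ℚ.≤ ∑ xs f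
term≤∑ (x ∷ xs) f 0≤f (here refl)  = ≤-by-difference (∑ xs f) refl (∑-nonNeg xs f 0≤f)
term≤∑ (x ∷ xs) f 0≤f (there x∈xs) = ℚ.≤-trans (term≤∑ xs f 0≤f x∈xs)
  (≤-by-difference (f x) (ℚ.+-comm _ (f x)) (0≤f x))

∏-nonNeg : ∀ (xs : List A) f → (∀ x → 0ℚ ℚ.≤ f x) → 0ℚ ℚ.≤ ∏ xs f
∏-nonNeg []       f 0≤f = 0≤1
∏-nonNeg (x ∷ xs) f 0≤f = 0≤* (0≤f x) (∏-nonNeg xs f 0≤f)

-- If the head exceeds `t`, the tail must compensate for it, so the bound passes to the tail.
-- Decidability of the order on ℚ turns the averaging argument into a search.
below-average : ∀ (x : A) xs h t → ∑ (x ∷ xs) h ℚ.≤ ∑ (x ∷ xs) (λ _ → t) → ∃[ y ] h y ℚ.≤ t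
below-average x xs h t ∑h≤∑t with h x ℚ.≤? t
below-average x xs       h t ∑h≤∑t | yes hx≤t = x , hx≤t
below-average x []       h t ∑h≤∑t | no  hx≰t =
  contradiction (ℚ.<-≤-trans (ℚ.+-monoˡ-< 0ℚ (ℚ.≰⇒> hx≰t)) ∑h≤∑t) (ℚ.<-irrefl refl)
below-average x (y ∷ xs) h t ∑h≤∑t | no  hx≰t with ∑ (y ∷ xs) h ℚ.≤? ∑ (y ∷ xs) (λ _ → t)
... | yes ∑′ = below-average y xs h t ∑′
... | no ¬∑′ = contradiction (ℚ.<-≤-trans (ℚ.+-mono-< (ℚ.≰⇒> hx≰t) (ℚ.≰⇒> ¬∑′)) ∑h≤∑t) (ℚ.<-irrefl refl)

-- The weight `W i` does not involve the new element `r`, and the new factor is linear in `F i r`.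
-- Summing over all candidates `r` first therefore replaces each factor by at most `1 + d ν`, and
-- some `r` does no worse than the average.
potential-step : ∀ (a : A) as (is : List I) (F : I → A → ℚ) (W : I → ℚ) d ν → 0ℚ ℚ.≤ d →
  (∀ i → 0ℚ ℚ.≤ W i) →
  (∀ {i} → i ∈ is → ∑ (a ∷ as) (F i) ℚ.≤ ∑ (a ∷ as) (λ _ → ν)) →
  ∃[ r ] ∑ is (λ i → (1ℚ ℚ.+ d ℚ.* F i r) ℚ.* W i) ℚ.≤ (1ℚ ℚ.+ d ℚ.* ν) ℚ.* ∑ is W
potential-step {A} a as is F W d ν 0≤d 0≤W mean≤ν = below-average a as _ ((1ℚ ℚ.+ d ℚ.* ν) ℚ.* ∑ is W) (begin
    ∑ xs (λ r → ∑ is (λ i → (1ℚ ℚ.+ d ℚ.* F i r) ℚ.* W i))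
      ≡⟨ ∑-swap xs is (λ r i → (1ℚ ℚ.+ d ℚ.* F i r) ℚ.* W i) ⟩
    ∑ is (λ i → ∑ xs (λ r → (1ℚ ℚ.+ d ℚ.* F i r) ℚ.* W i))
      ≡⟨ ∑-cong is total ⟩
    ∑ is (λ i → (n ℚ.+ d ℚ.* ∑ xs (F i)) ℚ.* W i)
      ≤⟨ ∑-mono-≤ is (λ {i} i∈is → *-monoʳ-≤ (0≤W i) (ℚ.+-monoʳ-≤ n (*-monoˡ-≤ 0≤d
           (ℚ.≤-trans (mean≤ν i∈is) (ℚ.≤-reflexive (∑-const xs ν)))))) ⟩
    ∑ is (λ i → (n ℚ.+ d ℚ.* (n ℚ.* ν)) ℚ.* W i)
      ≡⟨ ∑-cong is (λ i → ℚ.*-comm (n ℚ.+ d ℚ.* (n ℚ.* ν)) (W i)) ⟩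
    ∑ is (λ i → W i ℚ.* (n ℚ.+ d ℚ.* (n ℚ.* ν)))
      ≡⟨ ∑-*ʳ is W (n ℚ.+ d ℚ.* (n ℚ.* ν)) ⟩
    ∑ is W ℚ.* (n ℚ.+ d ℚ.* (n ℚ.* ν))
      ≡⟨ solve 4 (λ Φ n d ν → Φ :* (n :+ d :* (n :* ν)) := n :* ((con 1ℚ :+ d :* ν) :* Φ)) refl (∑ is W) n d ν ⟩
    n ℚ.* ((1ℚ ℚ.+ d ℚ.* ν) ℚ.* ∑ is W)
      ≡⟨ ∑-const xs ((1ℚ ℚ.+ d ℚ.* ν) ℚ.* ∑ is W) ⟨
    ∑ xs (λ _ → (1ℚ ℚ.+ d ℚ.* ν) ℚ.* ∑ is W) ∎)
  where
  open ℚ.≤-Reasoning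
  xs = a ∷ as
  n  = ℕ⇒ℚ (List.length xs)
  total : ∀ i → ∑ xs (λ r → (1ℚ ℚ.+ d ℚ.* F i r) ℚ.* W i) ≡ (n ℚ.+ d ℚ.* ∑ xs (F i)) ℚ.* W i
  total i = trans (∑-*ʳ xs (λ r → 1ℚ ℚ.+ d ℚ.* F i r) (W i)) (cong (ℚ._* W i)
    (trans (∑-+ xs (λ _ → 1ℚ) (λ r → d ℚ.* F i r)) (cong₂ ℚ._+_
      (trans (∑-const xs 1ℚ) (ℚ.*-identityʳ n))
      (trans (∑-cong xs (λ r → ℚ.*-comm d (F i r))) (trans (∑-*ʳ xs (F i) d) (ℚ.*-comm (∑ xs (F i)) d))))))

-- Choosing the sample one element at a time, so that the potential
-- ∑_F ∏_r (1 + d F(r)) never exceeds its average, derandomizes the Chernoff bound.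
greedy-sample : ∀ (a : A) as (is : List I) (F : I → A → ℚ) d ν → 0ℚ ℚ.≤ d → 0ℚ ℚ.≤ ν →
  (∀ i r → 0ℚ ℚ.≤ F i r) →
  (∀ {i} → i ∈ is → ∑ (a ∷ as) (F i) ℚ.≤ ∑ (a ∷ as) (λ _ → ν)) →
  ∀ K → ∃[ R ] (List.length R ≡ K ×
    ∑ is (λ i → ∏ R (λ r → 1ℚ ℚ.+ d ℚ.* F i r)) ℚ.≤ (1ℚ ℚ.+ d ℚ.* ν) ^ℚ K ℚ.* ℕ⇒ℚ (List.length is))
greedy-sample a as is F d ν 0≤d 0≤ν 0≤F mean≤ν zero =
  [] , refl , ℚ.≤-reflexive (trans (∑-const is 1ℚ) (ℚ.*-comm (ℕ⇒ℚ (List.length is)) 1ℚ))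
greedy-sample a as is F d ν 0≤d 0≤ν 0≤F mean≤ν (suc K) =
  let R , |R|≡K , Φ≤ = greedy-sample a as is F d ν 0≤d 0≤ν 0≤F mean≤ν K
      r , Φ′≤ = potential-step a as is F (λ i → ∏ R (λ r → 1ℚ ℚ.+ d ℚ.* F i r)) d ν 0≤d
        (λ i → ∏-nonNeg R _ (λ r → 0≤+ 0≤1 (0≤* 0≤d (0≤F i r)))) mean≤ν
  in r ∷ R , cong suc |R|≡K , ℚ.≤-trans Φ′≤ (ℚ.≤-trans
       (*-monoˡ-≤ (0≤+ 0≤1 (0≤* 0≤d 0≤ν)) Φ≤)
       (ℚ.≤-reflexive (sym (ℚ.*-assoc (1ℚ ℚ.+ d ℚ.* ν) ((1ℚ ℚ.+ d ℚ.* ν) ^ℚ K) (ℕ⇒ℚ (List.length is))))))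

-- For 0 ≤ x ≤ 1 the product ∏ (1 + d x) is at least g(∑ x), where g is the
-- piecewise linear function through the points (j , (1 + d)^j).
interpolation : ∀ (R : List A) F d → 0ℚ ℚ.≤ d → (∀ r → 0ℚ ℚ.≤ F r) → (∀ r → F r ℚ.≤ 1ℚ) →
  ∀ j f → 0ℚ ℚ.≤ f → f ℚ.≤ 1ℚ → ℕ⇒ℚ j ℚ.+ f ℚ.≤ ∑ R F →
  (1ℚ ℚ.+ d) ^ℚ j ℚ.* (1ℚ ℚ.+ d ℚ.* f) ℚ.≤ ∏ R (λ r → 1ℚ ℚ.+ d ℚ.* F r)
interpolation [] F d 0≤d 0≤F F≤1 zero f 0≤f f≤1 j+f≤ =
  ℚ.≤-reflexive (trans (cong (λ f → 1ℚ ℚ.* (1ℚ ℚ.+ d ℚ.* f)) f≡0)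
    (solve 1 (λ d → con 1ℚ :* (con 1ℚ :+ d :* con 0ℚ) := con 1ℚ) refl d))
  where
  f≡0 : f ≡ 0ℚ
  f≡0 = ℚ.≤-antisym (ℚ.≤-trans (ℚ.≤-reflexive (sym (ℚ.+-identityˡ f))) j+f≤) 0≤f
interpolation [] F d 0≤d 0≤F F≤1 (suc j) f 0≤f f≤1 j+f≤ = contradiction
  (ℚ.<-≤-trans (ℚ.≤-<-trans (ℕ⇒ℚ-nonNeg j) (n<1+n j))
    (ℚ.≤-trans (≤-by-difference f refl 0≤f) j+f≤))
  (ℚ.<-irrefl refl)
interpolation (r ∷ R) F d 0≤d 0≤F F≤1 j f 0≤f f≤1 j+f≤ = by-cases j j+f≤ (x ℚ.≤? f)
  where
  x = F r
  P = ∏ R (λ r → 1ℚ ℚ.+ d ℚ.* F r)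
  S = ∑ R F
  0≤1+dx : 0ℚ ℚ.≤ 1ℚ ℚ.+ d ℚ.* x
  0≤1+dx = 0≤+ 0≤1 (0≤* 0≤d (0≤F r))
  drop-x : ∀ {t} → x ℚ.+ t ℚ.≤ x ℚ.+ S → t ℚ.≤ S
  drop-x {t} x+t≤ = subst₂ ℚ._≤_ (cancel t) (cancel S) (ℚ.+-monoʳ-≤ (ℚ.- x) x+t≤)
    where
    cancel : ∀ t → ℚ.- x ℚ.+ (x ℚ.+ t) ≡ t
    cancel t = solve 2 (λ x t → :- x :+ (x :+ t) := t) refl x t
  by-cases : ∀ j → ℕ⇒ℚ j ℚ.+ f ℚ.≤ x ℚ.+ S → Dec (x ℚ.≤ f) →
    (1ℚ ℚ.+ d) ^ℚ j ℚ.* (1ℚ ℚ.+ d ℚ.* f) ℚ.≤ (1ℚ ℚ.+ d ℚ.* x) ℚ.* P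
  -- `x` is paid out of the fractional part. Splitting `f` into `x` and `f - x` only increases the
  -- product, by the cross term `d² x (f - x)`.
  by-cases j j+f≤ (yes x≤f) = ℚ.≤-trans
    (≤-by-difference (D ℚ.* (d ℚ.* d ℚ.* (x ℚ.* (f ℚ.- x))))
      (solve 4 (λ D d x f → D :* (con 1ℚ :+ d :* f) :+ D :* (d :* d :* (x :* (f :- x)))
         := (con 1ℚ :+ d :* x) :* (D :* (con 1ℚ :+ d :* (f :- x)))) refl D d x f)
      (0≤* (^-nonNeg j (0≤+ 0≤1 0≤d)) (0≤* (0≤* 0≤d 0≤d) (0≤* (0≤F r) (0≤q-p x≤f)))))
    (*-monoˡ-≤ 0≤1+dx (interpolation R F d 0≤d 0≤F F≤1 j (f ℚ.- x) (0≤q-p x≤f)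
      (ℚ.≤-trans (≤-by-difference x (solve 2 (λ f x → f :- x :+ x := f) refl f x) (0≤F r)) f≤1)
      (drop-x (ℚ.≤-trans (ℚ.≤-reflexive (solve 3 (λ x j f → x :+ (j :+ (f :- x)) := j :+ f) refl x (ℕ⇒ℚ j) f)) j+f≤))))
    where D = (1ℚ ℚ.+ d) ^ℚ j
  -- No whole unit is left to borrow, but the factor of `x` alone exceeds `1 + d f` and the others
  -- are at least 1.
  by-cases zero f≤ (no x≰f) = ℚ.≤-trans
    (ℚ.≤-trans (ℚ.≤-reflexive (ℚ.*-identityˡ _))
      (ℚ.≤-trans (ℚ.+-monoʳ-≤ 1ℚ (*-monoˡ-≤ 0≤d (ℚ.<⇒≤ (ℚ.≰⇒> x≰f))))
        (ℚ.≤-reflexive (sym (ℚ.*-identityʳ _)))))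
    (*-monoˡ-≤ 0≤1+dx (∏≥1 R))
    where
    ∏≥1 : ∀ R → 1ℚ ℚ.≤ ∏ R (λ r → 1ℚ ℚ.+ d ℚ.* F r)
    ∏≥1 []      = ℚ.≤-refl
    ∏≥1 (r ∷ R) = *-mono-≤ 0≤1 (ℚ.≤-trans 0≤1 (∏≥1 R)) (≤-by-difference (d ℚ.* F r) refl (0≤* 0≤d (0≤F r))) (∏≥1 R)
  -- One unit is borrowed, leaving the fractional part `1 - (x - f)`. Together with `x` it has the
  -- same sum as 1 and `f` but is less spread out, so its product is larger.
  by-cases (suc j) j+f≤ (no x≰f) = ℚ.≤-trans
    (≤-by-difference (D ℚ.* (d ℚ.* d ℚ.* ((x ℚ.- f) ℚ.* (1ℚ ℚ.- x))))
      (solve 4 (λ D d x f → (con 1ℚ :+ d) :* D :* (con 1ℚ :+ d :* f) :+ D :* (d :* d :* ((x :- f) :* (con 1ℚ :- x)))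
         := (con 1ℚ :+ d :* x) :* (D :* (con 1ℚ :+ d :* (con 1ℚ :- (x :- f))))) refl D d x f)
      (0≤* (^-nonNeg j (0≤+ 0≤1 0≤d)) (0≤* (0≤* 0≤d 0≤d) (0≤* 0≤x-f (0≤q-p (F≤1 r))))))
    (*-monoˡ-≤ 0≤1+dx (interpolation R F d 0≤d 0≤F F≤1 j (1ℚ ℚ.- (x ℚ.- f))
      (0≤q-p {x ℚ.- f} (ℚ.≤-trans (≤-by-difference f (solve 2 (λ x f → x :- f :+ f := x) refl x f) 0≤f) (F≤1 r)))
      (≤-by-difference (x ℚ.- f) (solve 1 (λ t → con 1ℚ :- t :+ t := con 1ℚ) refl (x ℚ.- f)) 0≤x-f)
      (drop-x (ℚ.≤-trans (ℚ.≤-reflexive (trans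
        (solve 3 (λ x j f → x :+ (j :+ (con 1ℚ :- (x :- f))) := con 1ℚ :+ j :+ f) refl x (ℕ⇒ℚ j) f)
        (cong (ℚ._+ f) (sym (ℕ⇒ℚ-suc j))))) j+f≤))))
    where
    D = (1ℚ ℚ.+ d) ^ℚ j
    0≤x-f : 0ℚ ℚ.≤ x ℚ.- f
    0≤x-f = 0≤q-p (ℚ.<⇒≤ (ℚ.≰⇒> x≰f))

∏-lower-bound : ∀ (R : List A) F d → 0ℚ ℚ.≤ d → (∀ r → 0ℚ ℚ.≤ F r) → (∀ r → F r ℚ.≤ 1ℚ) →
  ∀ T → ℕ⇒ℚ T ℚ.≤ ∑ R F → (1ℚ ℚ.+ d) ^ℚ T ℚ.≤ ∏ R (λ r → 1ℚ ℚ.+ d ℚ.* F r)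
∏-lower-bound R F d 0≤d 0≤F F≤1 T T≤∑ = ℚ.≤-trans
  (ℚ.≤-reflexive (solve 2 (λ D d → D := D :* (con 1ℚ :+ d :* con 0ℚ)) refl ((1ℚ ℚ.+ d) ^ℚ T) d))
  (interpolation R F d 0≤d 0≤F F≤1 T 0ℚ ℚ.≤-refl 0≤1 (ℚ.≤-trans (ℚ.≤-reflexive (ℚ.+-identityʳ (ℕ⇒ℚ T))) T≤∑))

¼ ¾ : ℚ
¼ = + 1 ℚ./ 4
¾ = + 3 ℚ./ 4

-- (1 + k/4L)^L ≤ (1 + 1/4L)^{kL} ≤ (1 - 1/4)^{-k}
[1+¼ν]^L*¾^k≤1 : ∀ k L ν → 0ℚ ℚ.≤ ν → ν ℚ.* ℕ⇒ℚ (suc L) ≡ ℕ⇒ℚ k →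
  (1ℚ ℚ.+ ¼ ℚ.* ν) ^ℚ suc L ℚ.* ¾ ^ℚ k ℚ.≤ 1ℚ
[1+¼ν]^L*¾^k≤1 k L-1 ν 0≤ν νL≡k = begin
  (1ℚ ℚ.+ ¼ ℚ.* ν) ^ℚ L ℚ.* ¾ ^ℚ k
    ≤⟨ *-monoʳ-≤ (^-nonNeg k 0≤¾) (^-monoˡ-≤ L (0≤+ 0≤1 (0≤* (ℚ.nonNegative⁻¹ ¼) 0≤ν)) 1+¼ν≤) ⟩
  ((1ℚ ℚ.+ y) ^ℚ k) ^ℚ L ℚ.* ¾ ^ℚ k
    ≡⟨ cong (ℚ._* ¾ ^ℚ k) (trans (^-assocʳ (1ℚ ℚ.+ y) k L) (trans (cong ((1ℚ ℚ.+ y) ^ℚ_) (ℕ.*-comm k L)) (sym (^-assocʳ (1ℚ ℚ.+ y) L k)))) ⟩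
  ((1ℚ ℚ.+ y) ^ℚ L) ^ℚ k ℚ.* ¾ ^ℚ k
    ≡⟨ ^-distrib-* ((1ℚ ℚ.+ y) ^ℚ L) ¾ k ⟨
  ((1ℚ ℚ.+ y) ^ℚ L ℚ.* ¾) ^ℚ k
    ≤⟨ ^-≤1 k (0≤* (^-nonNeg L (0≤+ 0≤1 0≤y)) 0≤¾) [1+y]^L*¾≤1 ⟩
  1ℚ ∎
  where
  open ℚ.≤-Reasoning
  L = suc L-1
  y = ¼ ℚ.* (+ 1 ℚ./ L)
  0≤¾ = ℚ.nonNegative⁻¹ ¾
  0≤y : 0ℚ ℚ.≤ y
  0≤y = 0≤* {¼} {+ 1 ℚ./ L} (ℚ.nonNegative⁻¹ ¼) (ℚ.nonNegative⁻¹ (+ 1 ℚ./ L) {{ℚ.normalize-nonNeg 1 L}})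
  L*y≡¼ : ℕ⇒ℚ L ℚ.* y ≡ ¼
  L*y≡¼ = trans (solve 3 (λ L q i → L :* (q :* i) := q :* (i :* L)) refl (ℕ⇒ℚ L) ¼ (+ 1 ℚ./ L))
    (trans (cong (¼ ℚ.*_) ([j/g]*g≡j 1 L)) (ℚ.*-identityʳ ¼))
  ky≡¼ν : ℕ⇒ℚ k ℚ.* y ≡ ¼ ℚ.* ν
  ky≡¼ν = trans (cong (ℚ._* y) (sym νL≡k)) (trans (ℚ.*-assoc ν (ℕ⇒ℚ L) y)
    (trans (cong (ν ℚ.*_) L*y≡¼) (ℚ.*-comm ν ¼)))
  1+¼ν≤ : 1ℚ ℚ.+ ¼ ℚ.* ν ℚ.≤ (1ℚ ℚ.+ y) ^ℚ k
  1+¼ν≤ = ℚ.≤-trans (ℚ.≤-reflexive (cong (1ℚ ℚ.+_) (sym ky≡¼ν))) (bernoulli k 0≤y)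
  [1+y]^L*¾≤1 : (1ℚ ℚ.+ y) ^ℚ L ℚ.* ¾ ℚ.≤ 1ℚ
  [1+y]^L*¾≤1 = ℚ.≤-trans
    (ℚ.≤-reflexive (cong (λ t → (1ℚ ℚ.+ y) ^ℚ L ℚ.* (1ℚ ℚ.- t)) (sym L*y≡¼)))
    (bernoulli-reciprocal L 0≤y)

-- The gain when 3 failures are observed where 2 are expected: `(5/4)^3` is the weight they force,
-- while `(4/3)^2` bounds the growth of the potential. With `d = 1/4` the quotient is 1125/1024,
-- above 1.
⁵⁄₄ ρ : ℚ
⁵⁄₄ = 1ℚ ℚ.+ ¼
ρ   = ⁵⁄₄ ^ℚ 3 ℚ.* ¾ ^ℚ 2

1≤ρ : 1ℚ ℚ.≤ ρ
1≤ρ = from-yes (1ℚ ℚ.≤? ρ)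

-- As `ρ - 1 = 101/1024`, 11 is the least exponent for which Bernoulli's inequality reaches 2.
2^E≤ρ^11E : ∀ E → ℕ⇒ℚ (2 ℕ.^ E) ℚ.≤ ρ ^ℚ (11 ℕ.* E)
2^E≤ρ^11E E = ℚ.≤-trans (ℚ.≤-reflexive (ℕ⇒ℚ-^ 2 E))
  (ℚ.≤-trans (^-monoˡ-≤ E (ℕ⇒ℚ-nonNeg 2) 2≤ρ^11) (ℚ.≤-reflexive (^-assocʳ ρ 11 E)))
  where
  2≤ρ^11 : ℕ⇒ℚ 2 ℚ.≤ ρ ^ℚ 11
  2≤ρ^11 = ℚ.≤-trans (from-yes (ℕ⇒ℚ 2 ℚ.≤? 1ℚ ℚ.+ ℕ⇒ℚ 11 ℚ.* (ρ ℚ.- 1ℚ)))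
    (bernoulli {ρ ℚ.- 1ℚ} 11 (0≤q-p 1≤ρ))

[xᵐ]ⁿ : ∀ x m n k → m ℕ.* n ≡ k → (x ^ℚ m) ^ℚ n ≡ x ^ℚ k
[xᵐ]ⁿ x m n _ refl = ^-assocʳ x m n

-- With `Q = 11 E`, the threshold `T = 3 k Q` is `3/2 ν` times the sample size `K = 2 L Q`. A sum
-- above `T` would force a single weight of at least `(5/4)^T`, while the whole potential is at most
-- `(4/3)^(2 k Q)` times the number of indices. The quotient of these powers is `ρ^(k Q)`, which is
-- at least `2^E` and hence exceeds that number.
small-sample : ∀ (a : A) as (is : List I) (F : I → A → ℚ) ν k L E → 0ℚ ℚ.≤ ν → ν ℚ.* ℕ⇒ℚ (suc L) ≡ ℕ⇒ℚ (suc k) →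
  List.length is < 2 ℕ.^ E →
  (∀ i r → 0ℚ ℚ.≤ F i r) →
  (∀ i r → F i r ℚ.≤ 1ℚ) →
  (∀ {i} → i ∈ is → ∑ (a ∷ as) (F i) ℚ.≤ ∑ (a ∷ as) (λ _ → ν)) →
  ∃[ R ] (List.length R ≡ suc L ℕ.* (2 ℕ.* (11 ℕ.* E)) ×
    (∀ {i} → i ∈ is → ∑ R (F i) ℚ.≤ ℕ⇒ℚ (3 ℕ.* (suc k ℕ.* (11 ℕ.* E)))))
small-sample {I = I} a as is F ν k-1 L-1 E 0≤ν νL≡k |is|<2^E 0≤F F≤1 mean≤ν = R , |R|≡K , ∑≤T
  where
  k = suc k-1
  L = suc L-1
  Q = 11 ℕ.* E
  K = L ℕ.* (2 ℕ.* Q)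
  T = 3 ℕ.* (k ℕ.* Q)
  G = (1ℚ ℚ.+ ¼ ℚ.* ν) ^ℚ K
  -- The inverse of the bound `(4/3)^(2 k Q)` on `G`; multiplying by it avoids division.
  C = ¾ ^ℚ (2 ℕ.* (k ℕ.* Q))
  0≤¼ = ℚ.nonNegative⁻¹ ¼
  sample = greedy-sample a as is F ¼ ν 0≤¼ 0≤ν 0≤F mean≤ν K
  R = proj₁ sample
  |R|≡K = proj₁ (proj₂ sample)
  Φ≤ = proj₂ (proj₂ sample)
  0<C : 0ℚ ℚ.< C
  0<C = ^-pos (2 ℕ.* (k ℕ.* Q)) (ℚ.positive⁻¹ ¾)
  G*C≤1 : G ℚ.* C ℚ.≤ 1ℚ
  G*C≤1 = ℚ.≤-trans (ℚ.≤-reflexive (trans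
      (cong₂ ℚ._*_ (sym ([xᵐ]ⁿ (1ℚ ℚ.+ ¼ ℚ.* ν) L (2 ℕ.* Q) K refl)) (sym ([xᵐ]ⁿ ¾ k (2 ℕ.* Q) _ (commute k Q))))
      (sym (^-distrib-* ((1ℚ ℚ.+ ¼ ℚ.* ν) ^ℚ L) (¾ ^ℚ k) (2 ℕ.* Q)))))
    (^-≤1 (2 ℕ.* Q) (0≤* (^-nonNeg L (0≤+ 0≤1 (0≤* 0≤¼ 0≤ν))) (^-nonNeg k (ℚ.nonNegative⁻¹ ¾)))
      ([1+¼ν]^L*¾^k≤1 k L-1 ν 0≤ν νL≡k))
    where
    commute : ∀ k Q → k ℕ.* (2 ℕ.* Q) ≡ 2 ℕ.* (k ℕ.* Q)
    commute = solve-∀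
  2^E≤ : ℕ⇒ℚ (2 ℕ.^ E) ℚ.≤ ⁵⁄₄ ^ℚ T ℚ.* C
  -- `Q ≤ k Q` because the numerator of `ν` is positive.
  2^E≤ = ℚ.≤-trans (2^E≤ρ^11E E) (ℚ.≤-trans (^-monoʳ-≤ 1≤ρ (ℕ.m≤m+n Q (k-1 ℕ.* Q)))
    (ℚ.≤-reflexive (trans (^-distrib-* (⁵⁄₄ ^ℚ 3) (¾ ^ℚ 2) (k ℕ.* Q))
      (cong₂ ℚ._*_ (^-assocʳ ⁵⁄₄ 3 (k ℕ.* Q)) (^-assocʳ ¾ 2 (k ℕ.* Q))))))
  ∑≤T : ∀ {i} → i ∈ is → ∑ R (F i) ℚ.≤ ℕ⇒ℚ T
  ∑≤T {i} i∈is = ℚ.≮⇒≥ λ T<∑ → ℚ.<-irrefl {M} refl (ℚ.<-≤-trans (ℕ⇒ℚ-mono-< |is|<2^E) (begin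
      ℕ⇒ℚ (2 ℕ.^ E)              ≤⟨ 2^E≤ ⟩
      ⁵⁄₄ ^ℚ T ℚ.* C              ≤⟨ *-monoʳ-≤ (ℚ.<⇒≤ 0<C) (⁵⁄₄^T≤ T<∑) ⟩
      G ℚ.* M ℚ.* C               ≡⟨ solve 3 (λ G M C → G :* M :* C := G :* C :* M) refl G M C ⟩
      G ℚ.* C ℚ.* M               ≤⟨ *-monoʳ-≤ (ℕ⇒ℚ-nonNeg (List.length is)) G*C≤1 ⟩
      1ℚ ℚ.* M                    ≡⟨ ℚ.*-identityˡ M ⟩
      M                           ∎))
    where
    open ℚ.≤-Reasoning
    M = ℕ⇒ℚ (List.length is)
    weight : I → ℚ
    weight i = ∏ R (λ r → 1ℚ ℚ.+ ¼ ℚ.* F i r)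
    ⁵⁄₄^T≤ : ℕ⇒ℚ T ℚ.< ∑ R (F i) → ⁵⁄₄ ^ℚ T ℚ.≤ G ℚ.* M
    ⁵⁄₄^T≤ T<∑ = ℚ.≤-trans (∏-lower-bound R (F i) ¼ 0≤¼ (0≤F i) (F≤1 i) T (ℚ.<⇒≤ T<∑))
      (ℚ.≤-trans (term≤∑ is weight (λ i → ∏-nonNeg R _ (λ r → 0≤+ 0≤1 (0≤* 0≤¼ (0≤F i r)))) i∈is) Φ≤)

-- Real exponents

/-nonNeg : ∀ j g → .{{_ : ℕ.NonZero g}} → 0ℚ ℚ.≤ + j ℚ./ g
/-nonNeg j g = ℚ.nonNegative⁻¹ (+ j ℚ./ g) {{ℚ.normalize-nonNeg j g}}

↥p≡+∣↥p∣ : ∀ p → 0ℚ ℚ.≤ p → ↥ p ≡ + ℤ.∣ ↥ p ∣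
↥p≡+∣↥p∣ (mkℚ (+ n) _ _)        0≤p = refl
↥p≡+∣↥p∣ p@(mkℚ -[1+ n ] _ _) 0≤p = contradiction (ℚ.<-≤-trans (ℚ.negative⁻¹ p) 0≤p) (ℚ.<-irrefl refl)

p*↧p≡↥p : ∀ p s → ↥ p ≡ + s → p ℚ.* ℕ⇒ℚ (↧ₙ p) ≡ ℕ⇒ℚ s
p*↧p≡↥p p s ↥p≡s = trans (cong (ℚ._* ℕ⇒ℚ (↧ₙ p)) (sym (trans (cong (ℚ._/ ↧ₙ p) (sym ↥p≡s)) (ℚ.↥p/↧p≡p p))))
  ([j/g]*g≡j s (↧ₙ p))

ℕ⇒ℚ-pos : ∀ n → 0ℚ ℚ.< ℕ⇒ℚ (suc n)
ℕ⇒ℚ-pos n = ℚ.≤-<-trans (ℕ⇒ℚ-nonNeg n) (n<1+n n)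

/-mono-< : ∀ {j k} g → j < k → + j ℚ./ suc g ℚ.< + k ℚ./ suc g
/-mono-< {j} {k} g j<k = *-cancelʳ-< (ℕ⇒ℚ-nonNeg (suc g))
  (subst₂ ℚ._<_ (sym ([j/g]*g≡j j (suc g))) (sym ([j/g]*g≡j k (suc g))) (ℕ⇒ℚ-mono-< j<k))

C*g/g≡C : ∀ C g → + (C ℕ.* suc g) ℚ./ suc g ≡ ℕ⇒ℚ C
C*g/g≡C C g = ℚ.≤-antisym (*-cancelʳ-≤ (ℕ⇒ℚ-pos g) (ℚ.≤-reflexive eq)) (*-cancelʳ-≤ (ℕ⇒ℚ-pos g) (ℚ.≤-reflexive (sym eq)))
  where
  eq : (+ (C ℕ.* suc g) ℚ./ suc g) ℚ.* ℕ⇒ℚ (suc g) ≡ ℕ⇒ℚ C ℚ.* ℕ⇒ℚ (suc g)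
  eq = trans ([j/g]*g≡j (C ℕ.* suc g) (suc g)) (ℕ⇒ℚ-* C (suc g))

q<1+∣↥q∣ : ∀ q → q ℚ.< ℕ⇒ℚ (suc ℤ.∣ ↥ q ∣)
q<1+∣↥q∣ q@(mkℚ (+ n) d-1 _) = *-cancelʳ-< (ℕ⇒ℚ-nonNeg (suc d-1))
  (subst₂ ℚ._<_ (sym (p*↧p≡↥p q n refl)) (ℕ⇒ℚ-* (suc n) (suc d-1)) (ℕ⇒ℚ-mono-< (ℕ.m≤m*n (suc n) (suc d-1))))
q<1+∣↥q∣ q@(mkℚ -[1+ n ] d-1 _) = ℚ.<-trans (ℚ.negative⁻¹ q) (ℕ⇒ℚ-pos (suc n))

natural-upper-bound : ∀ {c} → IsReal c → ∃[ C ] Upper c (ℕ⇒ℚ C)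
natural-upper-bound c-real = let q , c<q = upper-inhabited in suc ℤ.∣ ↥ q ∣ , upper-closed (q<1+∣↥q∣ q) c<q
  where open IsReal c-real

-- Rationals as cuts: they supply the real exponents `a` and `b` of the size bounds.
constant : ℚ → Cut
constant r = record { Lower = ℚ._< r ; Upper = r ℚ.<_ }

constant-isReal : ∀ r → IsReal (constant r)
constant-isReal r = record
  { lower-inhabited = r ℚ.- 1ℚ , subst₂ ℚ._<_ refl (ℚ.+-identityʳ r) (ℚ.+-monoʳ-< r (ℚ.negative⁻¹ (ℚ.- 1ℚ)))
  ; upper-inhabited = r ℚ.+ 1ℚ , subst₂ ℚ._<_ (ℚ.+-identityʳ r) refl (ℚ.+-monoʳ-< r 0<1)
  ; lower-closed    = ℚ.<-trans
  ; upper-closed    = λ q<s r<q → ℚ.<-trans r<q q<s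
  ; lower-open      = λ q<r → let m , q<m , m<r = ℚ.<-dense q<r in m , q<m , m<r
  ; upper-open      = λ r<q → let m , r<m , m<q = ℚ.<-dense r<q in m , m<q , r<m
  ; disjoint        = ℚ.<-asym
  ; located         = λ {q} {s} q<s → located q<s (q ℚ.<? r)
  }
  where
  located : ∀ {q s} → q ℚ.< s → Dec (q ℚ.< r) → q ℚ.< r ⊎ r ℚ.< s
  located q<s (yes q<r) = inj₁ q<r
  located q<s (no  q≮r) = inj₂ (ℚ.≤-<-trans (ℚ.≮⇒≥ q≮r) q<s)

⅞ : ℚ
⅞ = + 7 ℚ./ 8

-- `1 + 1/7` is the inverse of `⅞`, and Bernoulli's inequality already makes its power `7 n` at
-- least `1 + n`. The additional 1 keeps the exponent positive, since it will also serve as a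
-- denominator.
⅞^g*n<1 : ∀ n → ⅞ ^ℚ suc (7 ℕ.* n) ℚ.* ℕ⇒ℚ n ℚ.< 1ℚ
⅞^g*n<1 n = begin-strict
  ⅞ ^ℚ g ℚ.* ℕ⇒ℚ n               <⟨ ℚ.*-monoʳ-<-pos (⅞ ^ℚ g) {{ℚ.positive (^-pos g (ℚ.positive⁻¹ ⅞))}} n<⁸⁄₇^g ⟩
  ⅞ ^ℚ g ℚ.* (1ℚ ℚ.+ ⅐) ^ℚ g     ≡⟨ ^-distrib-* ⅞ (1ℚ ℚ.+ ⅐) g ⟨
  1ℚ ^ℚ g                         ≡⟨ 1^n≡1 g ⟩
  1ℚ                              ∎
  where
  open ℚ.≤-Reasoning
  g = suc (7 ℕ.* n)
  ⅐ = + 1 ℚ./ 7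
  n<⁸⁄₇^g : ℕ⇒ℚ n ℚ.< (1ℚ ℚ.+ ⅐) ^ℚ g
  n<⁸⁄₇^g = begin-strict
    ℕ⇒ℚ n                               <⟨ n<1+n n ⟩
    ℕ⇒ℚ (suc n)                         ≡⟨ ℕ⇒ℚ-suc n ⟩
    1ℚ ℚ.+ ℕ⇒ℚ n                        ≡⟨ cong (1ℚ ℚ.+_) (solve 1 (λ n → n := con (ℕ⇒ℚ 7) :* n :* con ⅐) refl (ℕ⇒ℚ n)) ⟩
    1ℚ ℚ.+ ℕ⇒ℚ 7 ℚ.* ℕ⇒ℚ n ℚ.* ⅐       ≡⟨ cong (λ m → 1ℚ ℚ.+ m ℚ.* ⅐) (ℕ⇒ℚ-* 7 n) ⟨
    1ℚ ℚ.+ ℕ⇒ℚ (7 ℕ.* n) ℚ.* ⅐          ≤⟨ bernoulli (7 ℕ.* n) (ℚ.nonNegative⁻¹ ⅐) ⟩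
    (1ℚ ℚ.+ ⅐) ^ℚ (7 ℕ.* n)             ≤⟨ ^-monoʳ-≤ (from-yes (1ℚ ℚ.≤? 1ℚ ℚ.+ ⅐)) (ℕ.n≤1+n (7 ℕ.* n)) ⟩
    (1ℚ ℚ.+ ⅐) ^ℚ g                     ∎

module NegativePower (N : ℕ) .{{_ : NonTrivial N}} where

  0<N^ : ∀ s → 0ℚ ℚ.< ℕ⇒ℚ (N ℕ.^ s)
  0<N^ s = ℕ⇒ℚ-mono-< (ℕ.m^n>0 N {{nonTrivial⇒nonZero N}} s)

  N^-s*N^s≡1 : ∀ s → N ^ℤ (ℤ.- (+ s)) ℚ.* ℕ⇒ℚ (N ℕ.^ s) ≡ 1ℚ
  N^-s*N^s≡1 zero    = refl
  N^-s*N^s≡1 (suc s) = [j/g]*g≡j 1 (N ℕ.^ suc s) {{ℕ.m^n≢0 N (suc s) {{nonTrivial⇒nonZero N}}}}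

  -- For p = - (j / g), comparing x^(↧ p) with N^(↥ p) amounts to comparing
  -- x^g N^j with 1, although j / g need not be in lowest terms.
  module Fraction (j g-1 : ℕ) (x : ℚ) (0≤x : 0ℚ ℚ.≤ x) where

    g s d : ℕ
    g = suc g-1
    p : ℚ
    p = + j ℚ./ g
    s = ℤ.∣ ↥ p ∣
    d = ↧ₙ p

    ↥p≡+s : ↥ p ≡ + s
    ↥p≡+s = ↥p≡+∣↥p∣ p (/-nonNeg j g)

    s*g≡j*d : s ℕ.* g ≡ j ℕ.* d
    s*g≡j*d = ℕ⇒ℚ-injective (begin
      ℕ⇒ℚ (s ℕ.* g)                ≡⟨ ℕ⇒ℚ-* s g ⟩
      ℕ⇒ℚ s ℚ.* ℕ⇒ℚ g              ≡⟨ cong (ℚ._* ℕ⇒ℚ g) (p*↧p≡↥p p s ↥p≡+s) ⟨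
      p ℚ.* ℕ⇒ℚ d ℚ.* ℕ⇒ℚ g        ≡⟨ solve 3 (λ p d g → p :* d :* g := p :* g :* d) refl p (ℕ⇒ℚ d) (ℕ⇒ℚ g) ⟩
      p ℚ.* ℕ⇒ℚ g ℚ.* ℕ⇒ℚ d        ≡⟨ cong (ℚ._* ℕ⇒ℚ d) ([j/g]*g≡j j g) ⟩
      ℕ⇒ℚ j ℚ.* ℕ⇒ℚ d              ≡⟨ ℕ⇒ℚ-* j d ⟨
      ℕ⇒ℚ (j ℕ.* d)                ∎)
      where open ≡-Reasoning

    -- Both sides are `x^(d g) N^(s g)`, since `s / d` is `j / g` in lowest terms. Taking positive
    -- powers and roots then carries a comparison with 1 from one form of the fraction to the other.
    powers-agree : (x ^ℚ d ℚ.* ℕ⇒ℚ (N ℕ.^ s)) ^ℚ g ≡ (x ^ℚ g ℚ.* ℕ⇒ℚ (N ℕ.^ j)) ^ℚ d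
    powers-agree = begin
      (x ^ℚ d ℚ.* ℕ⇒ℚ (N ℕ.^ s)) ^ℚ g               ≡⟨ expand d s g ⟩
      x ^ℚ (d ℕ.* g) ℚ.* ℕ⇒ℚ N ^ℚ (s ℕ.* g)         ≡⟨ cong₂ (λ m n → x ^ℚ m ℚ.* ℕ⇒ℚ N ^ℚ n) (ℕ.*-comm d g) s*g≡j*d ⟩
      x ^ℚ (g ℕ.* d) ℚ.* ℕ⇒ℚ N ^ℚ (j ℕ.* d)         ≡⟨ expand g j d ⟨
      (x ^ℚ g ℚ.* ℕ⇒ℚ (N ℕ.^ j)) ^ℚ d               ∎
      where
      open ≡-Reasoning
      expand : ∀ a b e → (x ^ℚ a ℚ.* ℕ⇒ℚ (N ℕ.^ b)) ^ℚ e ≡ x ^ℚ (a ℕ.* e) ℚ.* ℕ⇒ℚ N ^ℚ (b ℕ.* e)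
      expand a b e = trans (^-distrib-* (x ^ℚ a) (ℕ⇒ℚ (N ℕ.^ b)) e)
        (cong₂ ℚ._*_ (^-assocʳ x a e) (trans (cong (_^ℚ e) (ℕ⇒ℚ-^ N b)) (^-assocʳ (ℕ⇒ℚ N) b e)))

    N^↥≡ : N ^ℤ (↥ (ℚ.- p)) ≡ N ^ℤ (ℤ.- (+ s))
    N^↥≡ = cong (λ i → N ^ℤ i) (trans (ℚ.↥-neg p) (cong ℤ.-_ ↥p≡+s))

    x^↧≡ : (0ℚ ℚ.⊔ x) ^ℚ ↧ₙ (ℚ.- p) ≡ x ^ℚ d
    x^↧≡ = cong₂ _^ℚ_ (ℚ.p≤q⇒p⊔q≡q 0≤x) (ℤ.+-injective (ℚ.↧-neg p))

    small : x ^ℚ g ℚ.* ℕ⇒ℚ (N ℕ.^ j) ℚ.< 1ℚ → (0ℚ ℚ.⊔ x) ^ℚ ↧ₙ (ℚ.- p) ℚ.< N ^ℤ (↥ (ℚ.- p))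
    small x^gN^j<1 = subst₂ ℚ._<_ (sym x^↧≡) (sym N^↥≡) (*-cancelʳ-< (ℚ.<⇒≤ (0<N^ s))
      (subst (x ^ℚ d ℚ.* ℕ⇒ℚ (N ℕ.^ s) ℚ.<_) (sym (N^-s*N^s≡1 s))
        (^-cancelˡ-< g 0≤1 (subst₂ ℚ._<_ (sym powers-agree) (trans (1^n≡1 d) (sym (1^n≡1 g)))
          (^-monoˡ-< (ℚ.ℚ.denominator-1 p) (0≤* (^-nonNeg g 0≤x) (ℕ⇒ℚ-nonNeg (N ℕ.^ j))) x^gN^j<1)))))

    large : 1ℚ ℚ.< x ^ℚ g ℚ.* ℕ⇒ℚ (N ℕ.^ j) → N ^ℤ (↥ (ℚ.- p)) ℚ.< (0ℚ ℚ.⊔ x) ^ℚ ↧ₙ (ℚ.- p)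
    large 1<x^gN^j = subst₂ ℚ._<_ (sym N^↥≡) (sym x^↧≡) (*-cancelʳ-< (ℚ.<⇒≤ (0<N^ s))
      (subst (ℚ._< x ^ℚ d ℚ.* ℕ⇒ℚ (N ℕ.^ s)) (sym (N^-s*N^s≡1 s))
        (^-cancelˡ-< g (0≤* (^-nonNeg d 0≤x) (ℕ⇒ℚ-nonNeg (N ℕ.^ s)))
          (subst₂ ℚ._<_ (trans (1^n≡1 d) (sym (1^n≡1 g))) (sym powers-agree)
            (^-monoˡ-< (ℚ.ℚ.denominator-1 p) 0≤1 1<x^gN^j)))))

  module _ {c : Cut} (c-real : IsReal c) (1≤c : 1ℚ ℚ≤ c) (C : ℕ) (c<C : Upper c (ℕ⇒ℚ C)) where

    open IsReal c-real

    ε : Cut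
    ε = N ^ʳ neg c

    below-ε : ∀ j g-1 q → Upper c (+ j ℚ./ suc g-1) → 0ℚ ℚ.≤ q →
      q ^ℚ suc g-1 ℚ.* ℕ⇒ℚ (N ℕ.^ j) ℚ.< 1ℚ → Lower ε q
    below-ε j g-1 q c<p 0≤q small = ℚ.- p , subst (Upper c) (solve 1 (λ p → p := :- (:- p)) refl p) c<p ,
      Fraction.small j g-1 q 0≤q small
      where p = + j ℚ./ suc g-1

    above-ε : ∀ j g-1 q → Lower c (+ j ℚ./ suc g-1) → 0ℚ ℚ.≤ q →
      1ℚ ℚ.< q ^ℚ suc g-1 ℚ.* ℕ⇒ℚ (N ℕ.^ j) → Upper ε q
    above-ε j g-1 q p<c 0≤q large = ℚ.- p , subst (Lower c) (solve 1 (λ p → p := :- (:- p)) refl p) p<c ,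
      Fraction.large j g-1 q 0≤q large
      where p = + j ℚ./ suc g-1

    Lower-ε-mono : ∀ {q r} → q ℚ.≤ r → Lower ε r → Lower ε q
    Lower-ε-mono {q} {r} q≤r (p , c<-p , small) = p , c<-p ,
      ℚ.≤-<-trans (^-monoˡ-≤ (↧ₙ p) (ℚ.p≤p⊔q 0ℚ q) (ℚ.⊔-mono-≤ (ℚ.≤-refl {0ℚ}) q≤r)) small

    Upper-ε-mono : ∀ {q r} → q ℚ.≤ r → Upper ε q → Upper ε r
    Upper-ε-mono {q} {r} q≤r (p , -p<c , large) = p , -p<c ,
      ℚ.<-≤-trans large (^-monoˡ-≤ (↧ₙ p) (ℚ.p≤p⊔q 0ℚ q) (ℚ.⊔-mono-≤ (ℚ.≤-refl {0ℚ}) q≤r))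

    -- `located` cannot decide on which side of one point `c` lies, only choose between two
    -- neighbouring grid points. Hence an interval of two grid steps. The climb ends because `c`
    -- lies below `C`.
    bracket : ∀ g-1 → ∃[ j ] (Lower c (+ j ℚ./ suc g-1) × Upper c (+ (2 ℕ.+ j) ℚ./ suc g-1))
    bracket g-1 = search (C ℕ.* g) 0 (ℕ.+-identityʳ (C ℕ.* g)) 0<c
      where
      g = suc g-1
      -- `1 ≤ c` is a negative statement; locating `c` between 0 and 1 converts it into a usable
      -- lower bound.
      0<c : Lower c (+ 0 ℚ./ g)
      0<c = [ id , (λ c<1 → contradiction c<1 1≤c) ]′ (located
        (ℚ.<-≤-trans (/-mono-< {0} {g} g-1 (s≤s z≤n)) (ℚ.≤-reflexive
          (trans (cong (λ n → + n ℚ./ g) (sym (ℕ.*-identityˡ g))) (C*g/g≡C 1 g-1)))))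
      search : ∀ fuel j → fuel ℕ.+ j ≡ C ℕ.* g → Lower c (+ j ℚ./ g) →
        ∃[ j ] (Lower c (+ j ℚ./ g) × Upper c (+ (2 ℕ.+ j) ℚ./ g))
      search zero       j refl j/g<c = contradiction (c<C) (disjoint (subst (Lower c) (C*g/g≡C C g-1) j/g<c))
      search (suc fuel) j eq   j/g<c =
        [ search fuel (suc j) (trans (ℕ.+-suc fuel j) eq)
        , (λ upper → j , j/g<c , upper)
        ]′ (located (/-mono-< {suc j} {2 ℕ.+ j} g-1 (ℕ.n<1+n (suc j))))

    -- With `c` between `j / g` and `(j + 2) / g`, the decidable test is whether `q^g N^j` exceeds
    -- 1. If so, `q` is above `N^(-j/g)` and thus above `ε`. If not, passing to `N^(-(j+2)/g)` costs
    -- a factor `N²` in the `g`-th power, and `g = 7 N² + 1` is chosen so that `⅞^g` outweighs it.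
    located-ε : ∀ q → 0ℚ ℚ.≤ q → Lower ε (⅞ ℚ.* q) ⊎ Upper ε q
    located-ε q 0≤q =
      let j , lower , upper = bracket (7 ℕ.* N ℕ.^ 2)
      in decide j lower upper (1ℚ ℚ.<? q ^ℚ g ℚ.* ℕ⇒ℚ (N ℕ.^ j))
      where
      g = suc (7 ℕ.* N ℕ.^ 2)
      decide : ∀ j → Lower c (+ j ℚ./ g) → Upper c (+ (2 ℕ.+ j) ℚ./ g) →
        Dec (1ℚ ℚ.< q ^ℚ g ℚ.* ℕ⇒ℚ (N ℕ.^ j)) → Lower ε (⅞ ℚ.* q) ⊎ Upper ε q
      decide j lower upper (yes large) = inj₂ (above-ε j (7 ℕ.* N ℕ.^ 2) q lower 0≤q large)
      decide j lower upper (no ¬large) = inj₁ (below-ε (2 ℕ.+ j) (7 ℕ.* N ℕ.^ 2) (⅞ ℚ.* q) upper (0≤* (ℚ.nonNegative⁻¹ ⅞) 0≤q) (begin-strict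
        (⅞ ℚ.* q) ^ℚ g ℚ.* ℕ⇒ℚ (N ℕ.^ (2 ℕ.+ j))
          ≡⟨ cong₂ ℚ._*_ (^-distrib-* ⅞ q g) (trans (cong ℕ⇒ℚ (ℕ.^-distribˡ-+-* N 2 j)) (ℕ⇒ℚ-* (N ℕ.^ 2) (N ℕ.^ j))) ⟩
        ⅞ ^ℚ g ℚ.* q ^ℚ g ℚ.* (ℕ⇒ℚ (N ℕ.^ 2) ℚ.* ℕ⇒ℚ (N ℕ.^ j))
          ≡⟨ solve 4 (λ a b c d → a :* b :* (c :* d) := a :* c :* (b :* d)) refl (⅞ ^ℚ g) (q ^ℚ g) (ℕ⇒ℚ (N ℕ.^ 2)) (ℕ⇒ℚ (N ℕ.^ j)) ⟩
        ⅞ ^ℚ g ℚ.* ℕ⇒ℚ (N ℕ.^ 2) ℚ.* (q ^ℚ g ℚ.* ℕ⇒ℚ (N ℕ.^ j))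
          ≤⟨ *-monoˡ-≤ (0≤* (^-nonNeg g (ℚ.nonNegative⁻¹ ⅞)) (ℕ⇒ℚ-nonNeg (N ℕ.^ 2))) (ℚ.≮⇒≥ ¬large) ⟩
        ⅞ ^ℚ g ℚ.* ℕ⇒ℚ (N ℕ.^ 2) ℚ.* 1ℚ
          ≡⟨ ℚ.*-identityʳ _ ⟩
        ⅞ ^ℚ g ℚ.* ℕ⇒ℚ (N ℕ.^ 2)
          <⟨ ⅞^g*n<1 (N ℕ.^ 2) ⟩
        1ℚ ∎))
        where open ℚ.≤-Reasoning

    -- The rational substitute for `ε`: small enough for the conclusion, large enough to bound every
    -- probability that is at most `ε`. The premise `q ≤ 1` covers a search that runs to the end of
    -- the grid, where `ν = 1`.
    record Threshold (L-1 : ℕ) : Set where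
      field
        k-1   : ℕ
      ν : ℚ
      ν = + suc k-1 ℚ./ suc L-1
      field
        ¾ν<ε  : Lower ε (¾ ℚ.* ν)
        bound : ∀ {q} → q ℚ.≤ 1ℚ → q ℚ≤ ε → q ℚ.≤ ν

    threshold : ∀ L-1 → suc L-1 ≡ 6 ℕ.* N ℕ.^ C → Threshold L-1
    threshold L-1 L≡6N^C = search (L ℕ.∸ 6) 5 ℕ.≤-refl (ℕ.m∸n+n≡m 6≤L) 6/L<ε
      where
      L = suc L-1
      1≤N^C : 1 ≤ N ℕ.^ C
      1≤N^C = ℕ.m^n>0 N {{nonTrivial⇒nonZero N}} C
      6≤L : 6 ≤ L
      6≤L = subst (6 ≤_) (sym L≡6N^C) (ℕ.*-monoʳ-≤ 6 1≤N^C)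
      6/L*N^C≡1 : (+ 6 ℚ./ L) ℚ.* ℕ⇒ℚ (N ℕ.^ C) ≡ 1ℚ
      6/L*N^C≡1 = begin
        (+ 6 ℚ./ L) ℚ.* ℕ⇒ℚ (N ℕ.^ C)
          ≡⟨ solve 2 (λ q n → q :* n := q :* (con (ℕ⇒ℚ 6) :* n) :* con (+ 1 ℚ./ 6)) refl (+ 6 ℚ./ L) (ℕ⇒ℚ (N ℕ.^ C)) ⟩
        (+ 6 ℚ./ L) ℚ.* (ℕ⇒ℚ 6 ℚ.* ℕ⇒ℚ (N ℕ.^ C)) ℚ.* (+ 1 ℚ./ 6)
          ≡⟨ cong (λ n → (+ 6 ℚ./ L) ℚ.* n ℚ.* (+ 1 ℚ./ 6)) (trans (sym (ℕ⇒ℚ-* 6 (N ℕ.^ C))) (cong ℕ⇒ℚ (sym L≡6N^C))) ⟩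
        (+ 6 ℚ./ L) ℚ.* ℕ⇒ℚ L ℚ.* (+ 1 ℚ./ 6)
          ≡⟨ cong (ℚ._* (+ 1 ℚ./ 6)) ([j/g]*g≡j 6 L) ⟩
        ℕ⇒ℚ 6 ℚ.* (+ 1 ℚ./ 6) ∎
        where open ≡-Reasoning
      -- The grid is entered at its sixth point, which is `N^(-C)` because `L = 6 N^C`; `C` lies
      -- above `c`.
      6/L<ε : Lower ε (⅞ ℚ.* (+ 6 ℚ./ L))
      6/L<ε = below-ε C 0 (⅞ ℚ.* (+ 6 ℚ./ L)) (c<C) (0≤* {⅞} {+ 6 ℚ./ L} (ℚ.nonNegative⁻¹ ⅞) (/-nonNeg 6 L))
        (ℚ.≤-<-trans (ℚ.≤-reflexive (trans
          (solve 3 (λ t q n → (t :* q) :* con 1ℚ :* n := t :* (q :* n)) refl ⅞ (+ 6 ℚ./ L) (ℕ⇒ℚ (N ℕ.^ C)))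
          (cong (⅞ ℚ.*_) 6/L*N^C≡1))) (from-yes (⅞ ℚ.* 1ℚ ℚ.<? 1ℚ)))
      -- The search stops one grid step beyond the last point known to satisfy `⅞ k / L < ε`. From
      -- `k = 6` on, lowering `⅞` to `¾` absorbs that step, whence the factor 6 in `L`.
      ¾[k+1]≤⅞k : ∀ k → 6 ≤ k → ¾ ℚ.* (+ suc k ℚ./ L) ℚ.≤ ⅞ ℚ.* (+ k ℚ./ L)
      ¾[k+1]≤⅞k k 6≤k = *-cancelʳ-≤ (ℕ⇒ℚ-pos L-1) (begin
        ¾ ℚ.* (+ suc k ℚ./ L) ℚ.* ℕ⇒ℚ L        ≡⟨ scaled ¾ (suc k) ⟩
        ¾ ℚ.* ℕ⇒ℚ (suc k)                      ≡⟨ cong (¾ ℚ.*_) (ℕ⇒ℚ-suc k) ⟩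
        ¾ ℚ.* (1ℚ ℚ.+ ℕ⇒ℚ k)                   ≡⟨ solve 1 (λ k → con ¾ :* (con 1ℚ :+ k) := con ⅛ :* con (ℕ⇒ℚ 6) :+ con ¾ :* k) refl (ℕ⇒ℚ k) ⟩
        ⅛ ℚ.* ℕ⇒ℚ 6 ℚ.+ ¾ ℚ.* ℕ⇒ℚ k            ≤⟨ ℚ.+-monoˡ-≤ (¾ ℚ.* ℕ⇒ℚ k) (*-monoˡ-≤ (ℚ.nonNegative⁻¹ ⅛) (ℕ⇒ℚ-mono-≤ 6≤k)) ⟩
        ⅛ ℚ.* ℕ⇒ℚ k ℚ.+ ¾ ℚ.* ℕ⇒ℚ k            ≡⟨ solve 1 (λ k → con ⅛ :* k :+ con ¾ :* k := con ⅞ :* k) refl (ℕ⇒ℚ k) ⟩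
        ⅞ ℚ.* ℕ⇒ℚ k                            ≡⟨ scaled ⅞ k ⟨
        ⅞ ℚ.* (+ k ℚ./ L) ℚ.* ℕ⇒ℚ L            ∎)
        where
        open ℚ.≤-Reasoning
        ⅛ = + 1 ℚ./ 8
        scaled : ∀ t k → t ℚ.* (+ k ℚ./ L) ℚ.* ℕ⇒ℚ L ≡ t ℚ.* ℕ⇒ℚ k
        scaled t k = trans (ℚ.*-assoc t (+ k ℚ./ L) (ℕ⇒ℚ L)) (cong (t ℚ.*_) ([j/g]*g≡j k L))
      search : ∀ fuel k-1 → 5 ≤ k-1 → fuel ℕ.+ suc k-1 ≡ L → Lower ε (⅞ ℚ.* (+ suc k-1 ℚ./ L)) → Threshold L-1
      search zero       k-1 5≤k eq k/L<ε = record
        { k-1   = k-1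
        ; ¾ν<ε  = Lower-ε-mono (*-monoʳ-≤ {+ suc k-1 ℚ./ L} (/-nonNeg (suc k-1) L) (from-yes (¾ ℚ.≤? ⅞))) k/L<ε
        ; bound = λ q≤1 _ → ℚ.≤-trans q≤1 (ℚ.≤-reflexive (sym (trans (cong (λ n → + n ℚ./ L) (trans eq (sym (ℕ.*-identityˡ L)))) (C*g/g≡C 1 L-1))))
        }
      search (suc fuel) k-1 5≤k eq k/L<ε =
        [ search fuel (suc k-1) (ℕ.m≤n⇒m≤1+n 5≤k) (trans (ℕ.+-suc fuel (suc k-1)) eq)
        , (λ upper → record
            { k-1   = suc k-1
            ; ¾ν<ε  = Lower-ε-mono (¾[k+1]≤⅞k (suc k-1) (s≤s 5≤k)) k/L<ε
            ; bound = λ _ q≤ε → ℚ.≮⇒≥ (λ ν<q → q≤ε (Upper-ε-mono (ℚ.<⇒≤ ν<q) upper))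
            })
        ]′ (located-ε (+ (2 ℕ.+ k-1) ℚ./ L) (/-nonNeg (2 ℕ.+ k-1) L))

  N^a≤ : ∀ {K} → N ≤ K → (N ^ʳ constant 1ℚ) ≤ℚ ℕ⇒ℚ K
  N^a≤ {K} N≤K (p , p<1 , K^d<N^p) = impossible p p<1 (subst (λ x → x ^ℚ ↧ₙ p ℚ.< N ^ℤ (↥ p)) (ℚ.p≤q⇒p⊔q≡q (ℕ⇒ℚ-nonNeg K)) K^d<N^p)
    where
    instance _ = nonTrivial⇒nonZero N
    1≤N = ℕ.<⇒≤ (nonTrivial⇒n>1 N)
    impossible : ∀ p → p ℚ.< 1ℚ → ¬ (ℕ⇒ℚ K ^ℚ ↧ₙ p ℚ.< N ^ℤ (↥ p))
    impossible p@(mkℚ (+ s) d-1 _) p<1 K^d<N^s = ℕ.<-irrefl refl (begin-strict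
      K ℕ.^ d    <⟨ ℕ⇒ℚ-cancel-< (subst (ℚ._< ℕ⇒ℚ (N ℕ.^ s)) (sym (ℕ⇒ℚ-^ K d)) K^d<N^s) ⟩
      N ℕ.^ s    ≤⟨ ℕ.^-monoʳ-≤ N (ℕ.<⇒≤ s<d) ⟩
      N ℕ.^ d    ≤⟨ ℕ.^-monoˡ-≤ d N≤K ⟩
      K ℕ.^ d    ∎)
      where
      open ℕ.≤-Reasoning
      d = suc d-1
      s<d : s < d
      s<d = ℕ⇒ℚ-cancel-< (subst₂ ℚ._<_ (p*↧p≡↥p p s refl) (ℚ.*-identityˡ (ℕ⇒ℚ d)) (*-monoʳ-< (ℕ⇒ℚ-pos d-1) p<1))
    impossible (mkℚ -[1+ s ] d-1 _) p<1 K^d<N^-s = ℚ.<-irrefl refl (begin-strict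
      1ℚ                             ≤⟨ ^-≥1 (suc d-1) (ℕ⇒ℚ-mono-≤ {1} {K} (ℕ.≤-trans 1≤N N≤K)) ⟩
      ℕ⇒ℚ K ^ℚ suc d-1               <⟨ K^d<N^-s ⟩
      N ^ℤ -[1+ s ]                  ≤⟨ *-cancelʳ-≤ (0<N^ (suc s)) (begin
        N ^ℤ -[1+ s ] ℚ.* ℕ⇒ℚ (N ℕ.^ suc s)   ≡⟨ N^-s*N^s≡1 (suc s) ⟩
        1ℚ                                    ≤⟨ ℕ⇒ℚ-mono-≤ {1} (ℕ.m^n>0 N (suc s)) ⟩
        ℕ⇒ℚ (N ℕ.^ suc s)                     ≡⟨ ℚ.*-identityˡ (ℕ⇒ℚ (N ℕ.^ suc s)) ⟨
        1ℚ ℚ.* ℕ⇒ℚ (N ℕ.^ suc s)              ∎) ⟩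
      1ℚ                             ∎)
      where open ℚ.≤-Reasoning

  ≤N^b : ∀ {K} b → K ≤ N ℕ.^ b → ℕ⇒ℚ K ℚ≤ (N ^ʳ constant (ℕ⇒ℚ b))
  ≤N^b {K} b K≤N^b (p , b<p , N^p<K^d) = impossible p b<p (subst (λ x → N ^ℤ (↥ p) ℚ.< x ^ℚ ↧ₙ p) (ℚ.p≤q⇒p⊔q≡q (ℕ⇒ℚ-nonNeg K)) N^p<K^d)
    where
    instance _ = nonTrivial⇒nonZero N
    impossible : ∀ p → ℕ⇒ℚ b ℚ.< p → ¬ (N ^ℤ (↥ p) ℚ.< ℕ⇒ℚ K ^ℚ ↧ₙ p)
    impossible p@(mkℚ (+ s) d-1 _) b<p N^s<K^d = ℕ.<-irrefl refl (begin-strict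
      N ℕ.^ s            <⟨ ℕ⇒ℚ-cancel-< (subst (ℕ⇒ℚ (N ℕ.^ s) ℚ.<_) (sym (ℕ⇒ℚ-^ K d)) N^s<K^d) ⟩
      K ℕ.^ d            ≤⟨ ℕ.^-monoˡ-≤ d K≤N^b ⟩
      (N ℕ.^ b) ℕ.^ d    ≡⟨ ℕ.^-*-assoc N b d ⟩
      N ℕ.^ (b ℕ.* d)    ≤⟨ ℕ.^-monoʳ-≤ N (ℕ.<⇒≤ b*d<s) ⟩
      N ℕ.^ s            ∎)
      where
      open ℕ.≤-Reasoning
      d = suc d-1
      b*d<s : b ℕ.* d < s
      b*d<s = ℕ⇒ℚ-cancel-< (subst₂ ℚ._<_ (sym (ℕ⇒ℚ-* b d)) (p*↧p≡↥p p s refl) (*-monoʳ-< (ℕ⇒ℚ-pos d-1) b<p))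
    impossible p@(mkℚ -[1+ s ] d-1 _) b<p _ =
      ℚ.<-asym (ℚ.≤-<-trans (ℕ⇒ℚ-nonNeg b) b<p) (ℚ.negative⁻¹ p)

-- Failure probabilities

average : ∀ {k} → (Fin (suc k) → ℚ) → ℚ
average {k} t = (+ 1 ℚ./ suc k) ℚ.* sum ℚ.+-0-rawMonoid t

average-cong : ∀ {k} {t u : Fin (suc k) → ℚ} → (∀ i → t i ≡ u i) → average t ≡ average u
average-cong {k} t≡u = cong ((+ 1 ℚ./ suc k) ℚ.*_) (sum-cong-≗ t≡u)

sum-nonNeg : ∀ {n} (t : Fin n → ℚ) → (∀ i → 0ℚ ℚ.≤ t i) → 0ℚ ℚ.≤ sum ℚ.+-0-rawMonoid t
sum-nonNeg {zero}  t 0≤t = ℚ.≤-refl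
sum-nonNeg {suc n} t 0≤t = 0≤+ (0≤t zero) (sum-nonNeg (t ∘ suc) (0≤t ∘ suc))

sum≤n : ∀ {n} (t : Fin n → ℚ) → (∀ i → t i ℚ.≤ 1ℚ) → sum ℚ.+-0-rawMonoid t ℚ.≤ ℕ⇒ℚ n
sum≤n {zero}  t t≤1 = ℚ.≤-refl
sum≤n {suc n} t t≤1 = ℚ.≤-trans (ℚ.+-mono-≤ (t≤1 zero) (sum≤n (t ∘ suc) (t≤1 ∘ suc)))
  (ℚ.≤-reflexive (sym (ℕ⇒ℚ-suc n)))

average-nonNeg : ∀ {k} (t : Fin (suc k) → ℚ) → (∀ i → 0ℚ ℚ.≤ t i) → 0ℚ ℚ.≤ average t
average-nonNeg {k} t 0≤t = 0≤* {+ 1 ℚ./ suc k} (/-nonNeg 1 (suc k)) (sum-nonNeg t 0≤t)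

average≤1 : ∀ {k} (t : Fin (suc k) → ℚ) → (∀ i → t i ℚ.≤ 1ℚ) → average t ℚ.≤ 1ℚ
average≤1 {k} t t≤1 = ℚ.≤-trans (*-monoˡ-≤ {+ 1 ℚ./ suc k} (/-nonNeg 1 (suc k)) (sum≤n t t≤1))
  (ℚ.≤-reflexive ([j/g]*g≡j 1 (suc k)))

Pr-nonNeg : ∀ (m : Prob A) E → 0ℚ ℚ.≤ Pr m E
Pr-nonNeg (return a) E with E a
... | true  = 0≤1
... | false = ℚ.≤-refl
Pr-nonNeg (choose b) E = average-nonNeg (λ i → Pr (b i) E) (λ i → Pr-nonNeg (b i) E)

Pr≤1 : ∀ (m : Prob A) E → Pr m E ℚ.≤ 1ℚ
Pr≤1 (return a) E with E a
... | true  = ℚ.≤-refl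
... | false = 0≤1
Pr≤1 (choose b) E = average≤1 (λ i → Pr (b i) E) (λ i → Pr≤1 (b i) E)

sum-lookup : ∀ (xs : List A) (f : A → ℚ) → sum ℚ.+-0-rawMonoid (λ i → f (List.lookup xs i)) ≡ ∑ xs f
sum-lookup []       f = refl
sum-lookup (x ∷ xs) f = cong (f x ℚ.+_) (sum-lookup xs f)

Pr-uniform : ∀ (x : A) xs (f : A → Prob B) E →
  Pr (uniform (x ∷ xs) >>= f) E ℚ.* ℕ⇒ℚ (suc (List.length xs)) ≡ ∑ (x ∷ xs) (λ y → Pr (f y) E)
Pr-uniform x xs f E = begin
  i ℚ.* s ℚ.* n     ≡⟨ ℚ.*-assoc i s n ⟩
  i ℚ.* (s ℚ.* n)   ≡⟨ cong (i ℚ.*_) (ℚ.*-comm s n) ⟩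
  i ℚ.* (n ℚ.* s)   ≡⟨ ℚ.*-assoc i n s ⟨
  i ℚ.* n ℚ.* s     ≡⟨ cong (ℚ._* s) ([j/g]*g≡j 1 (suc (List.length xs))) ⟩
  1ℚ ℚ.* s          ≡⟨ ℚ.*-identityˡ s ⟩
  s                 ≡⟨ sum-lookup (x ∷ xs) (λ y → Pr (f y) E) ⟩
  ∑ (x ∷ xs) (λ y → Pr (f y) E) ∎
  where
  open ≡-Reasoning
  i = + 1 ℚ./ suc (List.length xs)
  s = sum ℚ.+-0-rawMonoid (λ i → Pr (f (List.lookup (x ∷ xs) i)) E)
  n = ℕ⇒ℚ (suc (List.length xs))

𝔼 : Prob A → (A → ℚ) → ℚ
𝔼 (return a) φ = φ a
𝔼 (choose b) φ = average (λ i → 𝔼 (b i) φ)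

infix 0 _≈_
-- Processes whose branches agree pointwise would be equal only up to function extensionality.
-- Comparing expectations of all observables sidesteps this and is compatible with `>>=`.
_≈_ : Prob A → Prob A → Set
m ≈ m′ = ∀ φ → 𝔼 m φ ≡ 𝔼 m′ φ

Pr≡𝔼 : ∀ (m : Prob A) E → Pr m E ≡ 𝔼 m (λ a → if E a then 1ℚ else 0ℚ)
Pr≡𝔼 (return a) E = refl
Pr≡𝔼 (choose b) E = average-cong (λ i → Pr≡𝔼 (b i) E)

𝔼-cong : ∀ (m : Prob A) {φ ψ : A → ℚ} → (∀ a → φ a ≡ ψ a) → 𝔼 m φ ≡ 𝔼 m ψ
𝔼-cong (return a) φ≡ψ = φ≡ψ a
𝔼-cong (choose b) φ≡ψ = average-cong (λ i → 𝔼-cong (b i) φ≡ψ)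

𝔼->>= : ∀ (m : Prob A) (f : A → Prob B) φ → 𝔼 (m >>= f) φ ≡ 𝔼 m (λ a → 𝔼 (f a) φ)
𝔼->>= (return a) f φ = refl
𝔼->>= (choose b) f φ = average-cong (λ i → 𝔼->>= (b i) f φ)

>>=-cong : ∀ (m m′ : Prob A) (f f′ : A → Prob B) → m ≈ m′ → (∀ a → f a ≈ f′ a) → m >>= f ≈ m′ >>= f′
>>=-cong m m′ f f′ m≈m′ f≈f′ φ = begin
  𝔼 (m >>= f) φ               ≡⟨ 𝔼->>= m f φ ⟩
  𝔼 m (λ a → 𝔼 (f a) φ)       ≡⟨ m≈m′ (λ a → 𝔼 (f a) φ) ⟩
  𝔼 m′ (λ a → 𝔼 (f a) φ)      ≡⟨ 𝔼-cong m′ (λ a → f≈f′ a φ) ⟩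
  𝔼 m′ (λ a → 𝔼 (f′ a) φ)     ≡⟨ 𝔼->>= m′ f′ φ ⟨
  𝔼 (m′ >>= f′) φ             ∎
  where open ≡-Reasoning

foldM-cong : ∀ (f f′ : B → A → Prob B) → (∀ b a → f b a ≈ f′ b a) → ∀ b as → foldM f b as ≈ foldM f′ b as
foldM-cong f f′ f≈f′ b []       φ = refl
foldM-cong f f′ f≈f′ b (a ∷ as) φ =
  >>=-cong (f b a) (f′ b a) (λ b′ → foldM f b′ as) (λ b′ → foldM f′ b′ as)
    (f≈f′ b a) (λ b′ → foldM-cong f f′ f≈f′ b′ as) φ

Pr-cong : ∀ (m m′ : Prob A) → m ≈ m′ → ∀ E → Pr m E ≡ Pr m′ E
Pr-cong m m′ m≈m′ E = trans (Pr≡𝔼 m E) (trans (m≈m′ _) (sym (Pr≡𝔼 m′ E)))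

module Adjacency (N c₀ tBC : ℕ) (rule : ProposalRule N) where

  open SharedBit N c₀ tBC rule

  -- The run as a function of the adjacency sets alone: these are finitely many,
  -- whereas a Graph also carries proofs, which are not unique up to _≡_.
  module _ {n : ℕ} (n≤N : n ≤ N) (r̂ : 𝓡) where

    module _ (adj : Vec (Subset n) n) (g : Fin tSSB) (A : Assignment n) where

      advertisedᵃ : Fin n → Bool
      advertisedᵃ u = List.foldr _xor_ false
        (List.map (λ t → bit r̂ g (bundle n≤N r̂ t) zero) (elements (lookup A u)))

      candidatesᵃ : Fin n → Subset n
      candidatesᵃ u = tabulate λ v → if advertisedᵃ v then false else lookup (lookup adj u) v

      -- The `with` of `proposal` as a function of its scrutinees, so that the two versions can be
      -- compared by cases; `connect` does the same for `accept`.
      pick : ∀ u S → Bool → Dec (Nonempty S) → Maybe (Fin n)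
      pick u S true (yes ne) = just (proj₁ (rule u S ne (tabulate λ k → bit r̂ g (bundle n≤N r̂ u) (suc k))))
      pick u S _    _        = nothing

      proposalᵃ : Fin n → Maybe (Fin n)
      proposalᵃ u = pick u (candidatesᵃ u) (advertisedᵃ u) (nonempty? (candidatesᵃ u))

      proposersᵃ : Fin n → List (Fin n)
      proposersᵃ v = List.filter (λ u → Maybe.≡-dec Fin._≟_ (proposalᵃ u) (just v)) (List.allFin n)

      connect : Assignment n → Fin n → List (Fin n) → Prob (Assignment n)
      connect B v []       = return B
      connect B v (u ∷ us) = uniform (u ∷ us) >>= λ w → return (transfer w v B)

      roundᵃ : Prob (Assignment n)
      roundᵃ = foldM (λ B v → connect B v (proposersᵃ v)) A (List.allFin n)

    module _ (G : Graph n) (g : Fin tSSB) (A : Assignment n) where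

      adj : Vec (Subset n) n
      adj = neighbors G

      proposal≡ : ∀ u → proposal n≤N r̂ G g A u ≡ proposalᵃ adj g A u
      proposal≡ u = unfold
        where
        unfold : proposal n≤N r̂ G g A u ≡ pick adj g A u (candidates n≤N r̂ G g A u)
          (advertised n≤N r̂ G g A u) (nonempty? (candidates n≤N r̂ G g A u))
        unfold with advertised n≤N r̂ G g A u | nonempty? (candidates n≤N r̂ G g A u)
        ... | true  | yes _ = refl
        ... | true  | no _  = refl
        ... | false | yes _ = refl
        ... | false | no _  = refl

      proposers≡ : ∀ v → proposers n≤N r̂ G g A v ≡ proposersᵃ adj g A v
      proposers≡ v = List.filter-≐ _ _
        ((λ {u} → trans (sym (proposal≡ u))) , (λ {u} → trans (proposal≡ u))) (List.allFin n)

      accept≡ : ∀ B v → accept n≤N r̂ G g A B v ≡ connect adj g A B v (proposersᵃ adj g A v)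
      accept≡ B v = trans unfold (cong (connect adj g A B v) (proposers≡ v))
        where
        unfold : accept n≤N r̂ G g A B v ≡ connect adj g A B v (proposers n≤N r̂ G g A v)
        unfold with proposers n≤N r̂ G g A v
        ... | []    = refl
        ... | _ ∷ _ = refl

      round≈ : round n≤N r̂ G g A ≈ roundᵃ adj g A
      round≈ = foldM-cong (accept n≤N r̂ G g A) (λ B v → connect adj g A B v (proposersᵃ adj g A v))
        (λ B v φ → cong (λ m → 𝔼 m φ) (accept≡ B v)) A (List.allFin n)

  Instance : Set
  Instance = Σ[ n ∈ ℕ ] (n ≤ N × Fin tBC × Vec (Vec (Subset n) n) tSB × Assignment n)

  Zᵃ : Instance → 𝓡 → Prob ℕ
  Zᵃ (n , n≤N , ℓ , 𝒢 , A) r̂ =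
    foldM (λ B s → roundᵃ n≤N r̂ (lookup 𝒢 s) (group n≤N r̂ ℓ s) B) A (List.allFin tSB)
      >>= λ B → return (if solved A B then 0 else 1)

  failure : Instance → 𝓡 → ℚ
  failure i r̂ = Pr (Zᵃ i r̂) (_≡ᵇ 1)

  module _ (n : ℕ) (n≤N : n ≤ N) (ℓ : Fin tBC) (𝒢 : DynamicGraph n) (A : Assignment n) where

    instanceᵃ : Instance
    instanceᵃ = n , n≤N , ℓ , Vec.map neighbors 𝒢 , A

    failure≡ : ∀ r̂ → Pr (Z n n≤N ℓ 𝒢 A r̂) (_≡ᵇ 1) ≡ failure instanceᵃ r̂
    failure≡ r̂ = Pr-cong (Z n n≤N ℓ 𝒢 A r̂) (Zᵃ instanceᵃ r̂)
      (>>=-cong (foldM step A (List.allFin tSB)) (foldM stepᵃ A (List.allFin tSB)) outcome outcome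
        (foldM-cong step stepᵃ step≈ A (List.allFin tSB)) (λ B φ → refl)) (_≡ᵇ 1)
      where
      step stepᵃ : Assignment n → Fin tSB → Prob (Assignment n)
      step  B s = round n≤N r̂ (lookup 𝒢 s) (group n≤N r̂ ℓ s) B
      stepᵃ B s = roundᵃ n≤N r̂ (lookup (Vec.map neighbors 𝒢) s) (group n≤N r̂ ℓ s) B
      outcome : Assignment n → Prob ℕ
      outcome B = return (if solved A B then 0 else 1)
      step≈ : ∀ B s → step B s ≈ stepᵃ B s
      step≈ B s φ = trans (round≈ n≤N r̂ (lookup 𝒢 s) (group n≤N r̂ ℓ s) B φ)
        (cong (λ adj → 𝔼 (roundᵃ n≤N r̂ adj (group n≤N r̂ ℓ s) B) φ) (sym (Vec.lookup-map s neighbors 𝒢)))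

    Pr[Z≡1]*length : ∀ R → Pr[Z≡1] R n n≤N ℓ 𝒢 A ℚ.* ℕ⇒ℚ (List⁺.length R) ≡ ∑ (List⁺.toList R) (failure instanceᵃ)
    Pr[Z≡1]*length (r ∷ rs) = trans (Pr-uniform r rs (Z n n≤N ℓ 𝒢 A) (_≡ᵇ 1)) (∑-cong (r ∷ rs) failure≡)

-- Counting the instances

length-cartesianProductWith : ∀ {C : Set} (f : A → B → C) xs ys →
  List.length (cartesianProductWith f xs ys) ≡ List.length xs ℕ.* List.length ys
length-cartesianProductWith f []       ys = refl
length-cartesianProductWith f (x ∷ xs) ys = trans (List.length-++ (List.map (f x) ys))
  (cong₂ ℕ._+_ (List.length-map (f x) ys) (length-cartesianProductWith f xs ys))

length-concatMap-≤ : ∀ (f : A → List B) b → (∀ x → List.length (f x) ≤ b) →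
  ∀ xs → List.length (concatMap f xs) ≤ List.length xs ℕ.* b
length-concatMap-≤ f b |f|≤b []       = z≤n
length-concatMap-≤ f b |f|≤b (x ∷ xs) = ℕ.≤-trans (ℕ.≤-reflexive (List.length-++ (f x)))
  (ℕ.+-mono-≤ (|f|≤b x) (length-concatMap-≤ f b |f|≤b xs))

vectors : List A → ∀ k → List (Vec A k)
vectors xs zero    = [] ∷ []
vectors xs (suc k) = cartesianProductWith _∷_ xs (vectors xs k)

length-vectors : ∀ (xs : List A) k → List.length (vectors xs k) ≡ List.length xs ℕ.^ k
length-vectors xs zero    = refl
length-vectors xs (suc k) = trans (length-cartesianProductWith _∷_ xs (vectors xs k))
  (cong (List.length xs ℕ.*_) (length-vectors xs k))

∈-vectors : ∀ {xs : List A} → (∀ x → x ∈ xs) → ∀ {k} (v : Vec A k) → v ∈ vectors xs k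
∈-vectors ∈xs []      = here refl
∈-vectors ∈xs (x ∷ v) = List.∈-cartesianProductWith⁺ _∷_ (∈xs x) (∈-vectors ∈xs v)

∈-bools : ∀ b → b ∈ true ∷ false ∷ []
∈-bools true  = here refl
∈-bools false = there (here refl)

assignments : ∀ n → List (Assignment n)
assignments n = vectors (vectors (true ∷ false ∷ []) n) n

∈-assignments : ∀ {n} (A : Assignment n) → A ∈ assignments n
∈-assignments = ∈-vectors (∈-vectors ∈-bools)

length-assignments : ∀ n → List.length (assignments n) ≡ 2 ℕ.^ (n ℕ.* n)
length-assignments n = trans (length-vectors (vectors (true ∷ false ∷ []) n) n)
  (trans (cong (ℕ._^ n) (length-vectors (true ∷ false ∷ []) n)) (ℕ.^-*-assoc 2 n n))

n<2^n : ∀ n → n < 2 ℕ.^ n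
n<2^n zero    = s≤s z≤n
n<2^n (suc n) = ℕ.≤-trans (ℕ.+-mono-≤ (ℕ.m^n>0 2 n) (n<2^n n))
  (ℕ.≤-reflexive (cong (2 ℕ.^ n ℕ.+_) (sym (ℕ.+-identityʳ (2 ℕ.^ n)))))

nonEmpty : ∀ (xs : List A) → 0 < List.length xs → ∃[ ys ] List⁺.toList ys ≡ xs
nonEmpty (x ∷ xs) _ = x ∷ xs , refl

module Enumeration (N c₀ tBC : ℕ) (rule : ProposalRule N) where

  open SharedBit N c₀ tBC rule
  open Adjacency N c₀ tBC rule

  Input : ℕ → Set
  Input n = Fin tBC × Vec (Vec (Subset n) n) tSB × Assignment n

  inputs : ∀ n → List (Input n)
  inputs n = cartesianProduct (allFin tBC) (cartesianProduct (vectors (assignments n) tSB) (assignments n))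

  ∈-inputs : ∀ {n} (x : Input n) → x ∈ inputs n
  ∈-inputs (ℓ , 𝒢 , A) = List.∈-cartesianProduct⁺ (List.∈-allFin ℓ)
    (List.∈-cartesianProduct⁺ (∈-vectors ∈-assignments 𝒢) (∈-assignments A))

  instancesAt : Fin (suc N) → List Instance
  instancesAt i = List.map (λ x → toℕ i , Fin.toℕ≤pred[n] i , x) (inputs (toℕ i))

  instances : List Instance
  instances = concatMap instancesAt (allFin (suc N))

  ∈-instances : ∀ (x : Instance) → x ∈ instances
  ∈-instances (n , n≤N , x) = member n≤N (Fin.toℕ≤pred[n] i) (Fin.toℕ-fromℕ< (s≤s n≤N)) x
    where
    i : Fin (suc N)
    i = fromℕ< (s≤s n≤N)
    member : ∀ {n} (n≤N : n ≤ N) (i≤N : toℕ i ≤ N) → toℕ i ≡ n → (x : Input n) → (n , n≤N , x) ∈ instances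
    -- The listed instance carries its own proof of `toℕ i ≤ N`, which has to be identified with the
    -- given one.
    member n≤N i≤N refl x = subst (λ p → (toℕ i , p , x) ∈ instances) (ℕ.≤-irrelevant (Fin.toℕ≤pred[n] i) n≤N)
      (List.∈-concatMap⁺ instancesAt (lose (List.∈-allFin i) (List.∈-map⁺ _ (∈-inputs x))))

  -- Generous numbers of bits for, in turn, `n`, the starting group `ℓ`, the adjacency matrices of
  -- all rounds and the initial assignment.
  bits : ℕ
  bits = suc N ℕ.+ (tBC ℕ.+ (N ℕ.* N ℕ.* tSB ℕ.+ N ℕ.* N))

  length-instancesAt : ∀ i → List.length (instancesAt i) ≤ 2 ℕ.^ (tBC ℕ.+ (N ℕ.* N ℕ.* tSB ℕ.+ N ℕ.* N))
  length-instancesAt i = begin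
    List.length (instancesAt i)                                           ≡⟨ List.length-map _ (inputs n) ⟩
    List.length (inputs n)                                                ≡⟨ |inputs| ⟩
    tBC ℕ.* ((2 ℕ.^ (n ℕ.* n)) ℕ.^ tSB ℕ.* 2 ℕ.^ (n ℕ.* n))              ≡⟨ cong (λ m → tBC ℕ.* (m ℕ.* 2 ℕ.^ (n ℕ.* n))) (ℕ.^-*-assoc 2 (n ℕ.* n) tSB) ⟩
    tBC ℕ.* (2 ℕ.^ (n ℕ.* n ℕ.* tSB) ℕ.* 2 ℕ.^ (n ℕ.* n))                ≡⟨ cong (tBC ℕ.*_) (ℕ.^-distribˡ-+-* 2 (n ℕ.* n ℕ.* tSB) (n ℕ.* n)) ⟨
    tBC ℕ.* 2 ℕ.^ (n ℕ.* n ℕ.* tSB ℕ.+ n ℕ.* n)                           ≤⟨ ℕ.*-mono-≤ (ℕ.<⇒≤ (n<2^n tBC)) (ℕ.^-monoʳ-≤ 2 (ℕ.+-mono-≤ (ℕ.*-monoˡ-≤ tSB n²≤N²) n²≤N²)) ⟩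
    2 ℕ.^ tBC ℕ.* 2 ℕ.^ (N ℕ.* N ℕ.* tSB ℕ.+ N ℕ.* N)                     ≡⟨ ℕ.^-distribˡ-+-* 2 tBC (N ℕ.* N ℕ.* tSB ℕ.+ N ℕ.* N) ⟨
    2 ℕ.^ (tBC ℕ.+ (N ℕ.* N ℕ.* tSB ℕ.+ N ℕ.* N))                         ∎
    where
    open ℕ.≤-Reasoning
    n = toℕ i
    n²≤N² : n ℕ.* n ≤ N ℕ.* N
    n²≤N² = ℕ.*-mono-≤ (Fin.toℕ≤pred[n] i) (Fin.toℕ≤pred[n] i)
    |inputs| : List.length (inputs n) ≡ tBC ℕ.* ((2 ℕ.^ (n ℕ.* n)) ℕ.^ tSB ℕ.* 2 ℕ.^ (n ℕ.* n))
    |inputs| = trans (length-cartesianProductWith _,_ (allFin tBC) _)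
      (cong₂ ℕ._*_ (List.length-tabulate {n = tBC} (λ i → i))
        (trans (length-cartesianProductWith _,_ (vectors (assignments n) tSB) (assignments n))
          (cong₂ ℕ._*_ (trans (length-vectors (assignments n) tSB) (cong (ℕ._^ tSB) (length-assignments n)))
            (length-assignments n))))

  length-instances : List.length instances < 2 ℕ.^ bits
  length-instances = begin-strict
    List.length instances               ≤⟨ length-concatMap-≤ instancesAt (2 ℕ.^ m) length-instancesAt (allFin (suc N)) ⟩
    List.length (allFin (suc N)) ℕ.* 2 ℕ.^ m    ≡⟨ cong (ℕ._* 2 ℕ.^ m) (List.length-tabulate {n = suc N} (λ i → i)) ⟩
    suc N ℕ.* 2 ℕ.^ m                   <⟨ ℕ.*-monoˡ-< (2 ℕ.^ m) {{ℕ.m^n≢0 2 m}} (n<2^n (suc N)) ⟩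
    2 ℕ.^ suc N ℕ.* 2 ℕ.^ m             ≡⟨ ℕ.^-distribˡ-+-* 2 (suc N) m ⟨
    2 ℕ.^ bits                          ∎
    where
    open ℕ.≤-Reasoning
    m = tBC ℕ.+ (N ℕ.* N ℕ.* tSB ℕ.+ N ℕ.* N)

-- Choosing the parameters

n≤N^n : ∀ {N} → 2 ≤ N → ∀ n → n ≤ N ℕ.^ n
n≤N^n 2≤N n = ℕ.≤-trans (ℕ.<⇒≤ (n<2^n n)) (ℕ.^-monoˡ-≤ n 2≤N)

⌈log₂n⌉≤n : ∀ n → ⌈log₂ n ⌉ ≤ n
⌈log₂n⌉≤n n = ℕ.≤-trans (⌈log₂⌉-mono-≤ (ℕ.<⇒≤ (n<2^n n))) (ℕ.≤-reflexive (⌈log₂2^n⌉≡n n))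

maximum-below : ∀ (t : ℕ → ℕ) N₀ → ∃[ m ] (∀ N → N < N₀ → t N ≤ m)
maximum-below t zero     = 0 , λ N ()
maximum-below t (suc N₀) = let m , t≤m = maximum-below t N₀ in
  m ℕ.⊔ t N₀ , λ N N<1+N₀ → split N (ℕ.m≤n⇒m<n∨m≡n (ℕ.≤-pred N<1+N₀)) t≤m
  where
  split : ∀ {m} N → N < N₀ ⊎ N ≡ N₀ → (∀ N → N < N₀ → t N ≤ m) → t N ≤ m ℕ.⊔ t N₀
  split N (inj₁ N<N₀) t≤m = ℕ.≤-trans (t≤m N N<N₀) (ℕ.m≤m⊔n _ _)
  split N (inj₂ refl) t≤m = ℕ.m≤n⊔m _ _

-- For `N ≥ 2` every constant `n` is absorbed by `N^n`, and the logarithm by `N`. The finitely many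
-- values below `N₀` are covered by their maximum `m`, and adding the exponents serves both ranges.
polynomially-bounded : ∀ {t} → QuadraticPolylog t → ∃[ e ] (∀ N → 2 ≤ N → t N ≤ N ℕ.^ e)
polynomially-bounded {t} (K , k , N₀ , t≤) = e , bound
  where
  m = proj₁ (maximum-below t N₀)
  t≤m = proj₂ (maximum-below t N₀)
  e = m ℕ.+ (K ℕ.+ 2 ℕ.+ k)
  bound : ∀ N → 2 ≤ N → t N ≤ N ℕ.^ e
  bound N 2≤N = by-cases (N ℕ.<? N₀)
    where
    instance _ = ℕ.>-nonZero (ℕ.<⇒≤ 2≤N)
    by-cases : Dec (N < N₀) → t N ≤ N ℕ.^ e
    by-cases (yes N<N₀) = ℕ.≤-trans (t≤m N N<N₀) (ℕ.≤-trans (n≤N^n 2≤N m) (ℕ.^-monoʳ-≤ N (ℕ.m≤m+n m _)))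
    by-cases (no  N≮N₀) = begin
      t N                                  ≤⟨ t≤ N (ℕ.≮⇒≥ N≮N₀) ⟩
      K ℕ.* N ℕ.^ 2 ℕ.* ⌈log₂ N ⌉ ℕ.^ k    ≤⟨ ℕ.*-mono-≤ (ℕ.*-monoˡ-≤ (N ℕ.^ 2) (n≤N^n 2≤N K)) (ℕ.^-monoˡ-≤ k (⌈log₂n⌉≤n N)) ⟩
      N ℕ.^ K ℕ.* N ℕ.^ 2 ℕ.* N ℕ.^ k      ≡⟨ cong (ℕ._* N ℕ.^ k) (ℕ.^-distribˡ-+-* N K 2) ⟨
      N ℕ.^ (K ℕ.+ 2) ℕ.* N ℕ.^ k          ≡⟨ ℕ.^-distribˡ-+-* N (K ℕ.+ 2) k ⟨
      N ℕ.^ (K ℕ.+ 2 ℕ.+ k)                ≤⟨ ℕ.^-monoʳ-≤ N (ℕ.m≤n+m (K ℕ.+ 2 ℕ.+ k) m) ⟩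
      N ℕ.^ e                              ∎
      where open ℕ.≤-Reasoning

module Sampling (c₀ N : ℕ) .{{_ : NonTrivial N}} (tBC : ℕ) (rule : ProposalRule N)
  {c : Cut} (c-real : IsReal c) (1≤c : 1ℚ ℚ≤ c) (C : ℕ) (c<C : Upper c (ℕ⇒ℚ C)) where

  open NegativePower N
  open SharedBit N c₀ tBC rule
  open Adjacency N c₀ tBC rule
  open Enumeration N c₀ tBC rule

  instance
    N-nonZero : ℕ.NonZero N
    N-nonZero = nonTrivial⇒nonZero N

  2≤N : 2 ≤ N
  2≤N = nonTrivial⇒n>1 N

  ε′ : Cut
  ε′ = N ^ʳ neg c

  -- `L` is the grid denominator of `ν`, given through its predecessor to be visibly positive; `K`
  -- is the size that `small-sample` produces for it.
  L-1 L K : ℕ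
  L-1 = ℕ.pred (6 ℕ.* N ℕ.^ C)
  L   = suc L-1
  K   = L ℕ.* (2 ℕ.* (11 ℕ.* bits))

  L≡6N^C : L ≡ 6 ℕ.* N ℕ.^ C
  L≡6N^C = ℕ.suc-pred (6 ℕ.* N ℕ.^ C) {{ℕ.m*n≢0 6 (N ℕ.^ C) {{_}} {{ℕ.m^n≢0 N C}}}}

  N≤K : N ≤ K
  N≤K = begin
    N                            ≤⟨ ℕ.n≤1+n N ⟩
    suc N                        ≤⟨ ℕ.m≤m+n (suc N) _ ⟩
    bits                         ≤⟨ ℕ.m≤n*m bits 11 ⟩
    11 ℕ.* bits                  ≤⟨ ℕ.m≤n*m (11 ℕ.* bits) 2 ⟩
    2 ℕ.* (11 ℕ.* bits)          ≤⟨ ℕ.m≤n*m (2 ℕ.* (11 ℕ.* bits)) L ⟩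
    K                            ∎
    where open ℕ.≤-Reasoning

  K≤ : ∀ e → tBC ≤ N ℕ.^ e → K ≤ N ℕ.^ (8 ℕ.+ C ℕ.+ (2 ℕ.+ (e ℕ.+ (4 ℕ.+ c₀))))
  K≤ e tBC≤ = begin
    L ℕ.* (2 ℕ.* (11 ℕ.* bits))                     ≡⟨ cong (ℕ._* (2 ℕ.* (11 ℕ.* bits))) L≡6N^C ⟩
    6 ℕ.* N ℕ.^ C ℕ.* (2 ℕ.* (11 ℕ.* bits))         ≡⟨ regroup (N ℕ.^ C) bits ⟩
    132 ℕ.* N ℕ.^ C ℕ.* bits                        ≤⟨ ℕ.*-mono-≤ (ℕ.*-monoˡ-≤ (N ℕ.^ C) 132≤N^8) bits≤ ⟩
    N ℕ.^ 8 ℕ.* N ℕ.^ C ℕ.* N ℕ.^ (2 ℕ.+ D)         ≡⟨ cong (ℕ._* N ℕ.^ (2 ℕ.+ D)) (ℕ.^-distribˡ-+-* N 8 C) ⟨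
    N ℕ.^ (8 ℕ.+ C) ℕ.* N ℕ.^ (2 ℕ.+ D)             ≡⟨ ℕ.^-distribˡ-+-* N (8 ℕ.+ C) (2 ℕ.+ D) ⟨
    N ℕ.^ (8 ℕ.+ C ℕ.+ (2 ℕ.+ D))                   ∎
    where
    open ℕ.≤-Reasoning
    -- Large enough for each of the four summands of `bits`: `e` accounts for `tBC`, and `4 + c₀`
    -- for `N² tSB = c₀ N^4`.
    D = e ℕ.+ (4 ℕ.+ c₀)
    regroup : ∀ n b → 6 ℕ.* n ℕ.* (2 ℕ.* (11 ℕ.* b)) ≡ 132 ℕ.* n ℕ.* b
    regroup = solve-∀
    -- 132 + 124 = 2^8.
    132≤N^8 : 132 ≤ N ℕ.^ 8
    132≤N^8 = ℕ.≤-trans (ℕ.m≤m+n 132 124) (ℕ.^-monoˡ-≤ 8 2≤N)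
    N^≤N^D : ∀ {m} → m ≤ D → N ℕ.^ m ≤ N ℕ.^ D
    N^≤N^D = ℕ.^-monoʳ-≤ N
    2≤D : 2 ≤ D
    2≤D = ℕ.≤-trans (ℕ.m≤m+n 2 (2 ℕ.+ c₀)) (ℕ.m≤n+m (4 ℕ.+ c₀) e)
    N*N≡N^2 : N ℕ.* N ≡ N ℕ.^ 2
    N*N≡N^2 = cong (N ℕ.*_) (sym (ℕ.*-identityʳ N))
    1+N≤ : suc N ≤ N ℕ.^ D
    1+N≤ = begin
      suc N        ≤⟨ ℕ.+-monoˡ-≤ N (ℕ.<⇒≤ 2≤N) ⟩
      N ℕ.+ N      ≡⟨ cong (N ℕ.+_) (ℕ.+-identityʳ N) ⟨
      2 ℕ.* N      ≤⟨ ℕ.*-monoˡ-≤ N 2≤N ⟩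
      N ℕ.* N      ≡⟨ N*N≡N^2 ⟩
      N ℕ.^ 2      ≤⟨ N^≤N^D 2≤D ⟩
      N ℕ.^ D      ∎
    NNtSB≤ : N ℕ.* N ℕ.* tSB ≤ N ℕ.^ D
    NNtSB≤ = begin
      N ℕ.* N ℕ.* (c₀ ℕ.* N ℕ.^ 2)            ≤⟨ ℕ.*-mono-≤ (ℕ.≤-reflexive N*N≡N^2) (ℕ.*-monoˡ-≤ (N ℕ.^ 2) (n≤N^n 2≤N c₀)) ⟩
      N ℕ.^ 2 ℕ.* (N ℕ.^ c₀ ℕ.* N ℕ.^ 2)      ≡⟨ rotate (N ℕ.^ 2) (N ℕ.^ c₀) ⟩
      N ℕ.^ 2 ℕ.* N ℕ.^ 2 ℕ.* N ℕ.^ c₀        ≡⟨ cong (ℕ._* N ℕ.^ c₀) (ℕ.^-distribˡ-+-* N 2 2) ⟨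
      N ℕ.^ 4 ℕ.* N ℕ.^ c₀                    ≡⟨ ℕ.^-distribˡ-+-* N 4 c₀ ⟨
      N ℕ.^ (4 ℕ.+ c₀)                        ≤⟨ N^≤N^D (ℕ.m≤n+m (4 ℕ.+ c₀) e) ⟩
      N ℕ.^ D                                 ∎
      where
      rotate : ∀ a b → a ℕ.* (b ℕ.* a) ≡ a ℕ.* a ℕ.* b
      rotate = solve-∀
    bits≤ : bits ≤ N ℕ.^ (2 ℕ.+ D)
    bits≤ = begin
      bits
        ≤⟨ ℕ.+-mono-≤ 1+N≤ (ℕ.+-mono-≤ (ℕ.≤-trans tBC≤ (N^≤N^D (ℕ.m≤m+n e (4 ℕ.+ c₀))))
             (ℕ.+-mono-≤ NNtSB≤ (ℕ.≤-trans (ℕ.≤-reflexive N*N≡N^2) (N^≤N^D 2≤D)))) ⟩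
      N ℕ.^ D ℕ.+ (N ℕ.^ D ℕ.+ (N ℕ.^ D ℕ.+ N ℕ.^ D))   ≡⟨ four (N ℕ.^ D) ⟩
      2 ℕ.^ 2 ℕ.* N ℕ.^ D                               ≤⟨ ℕ.*-monoˡ-≤ (N ℕ.^ D) (ℕ.^-monoˡ-≤ 2 2≤N) ⟩
      N ℕ.^ 2 ℕ.* N ℕ.^ D                               ≡⟨ ℕ.^-distribˡ-+-* N 2 D ⟨
      N ℕ.^ (2 ℕ.+ D)                                   ∎
      where
      four : ∀ x → x ℕ.+ (x ℕ.+ (x ℕ.+ x)) ≡ 4 ℕ.* x
      four = solve-∀

  open Threshold (threshold c-real 1≤c C c<C L-1 L≡6N^C)

  k : ℕ
  k = suc k-1

  νL≡k : ν ℚ.* ℕ⇒ℚ L ≡ ℕ⇒ℚ k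
  νL≡k = [j/g]*g≡j k L

  mean : Instance → ℚ
  mean x = ∑ (List⁺.toList all𝓡) (failure x)

  -- Selects the inputs for which the sample is to work. Since the test is on rational sums, the
  -- sample can be built before the hypothesis on failure probabilities is invoked.
  typical? : ∀ x → Dec (mean x ℚ.≤ ∑ (List⁺.toList all𝓡) (λ _ → ν))
  typical? x = mean x ℚ.≤? ∑ (List⁺.toList all𝓡) (λ _ → ν)

  sample : ∃[ R ] (List.length R ≡ K ×
    (∀ {x} → x ∈ List.filter typical? instances → ∑ R (failure x) ℚ.≤ ℕ⇒ℚ (3 ℕ.* (k ℕ.* (11 ℕ.* bits)))))
  sample = small-sample (List⁺.head all𝓡) (List⁺.tail all𝓡) (List.filter typical? instances) failure ν k-1 L-1 bits
    (/-nonNeg k L) νL≡k (ℕ.≤-<-trans (List.length-filter typical? instances) length-instances)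
    (λ x r̂ → Pr-nonNeg (Zᵃ x r̂) _) (λ x r̂ → Pr≤1 (Zᵃ x r̂) _)
    (λ x∈ → proj₂ (List.∈-filter⁻ typical? {xs = instances} x∈))

  module _ (n : ℕ) (n≤N : n ≤ N) (ℓ : Fin tBC) (𝒢 : DynamicGraph n) (A : Assignment n) where

    x : Instance
    x = instanceᵃ n n≤N ℓ 𝒢 A

    typical : Pr[Z≡1] all𝓡 n n≤N ℓ 𝒢 A ℚ≤ ε′ → mean x ℚ.≤ ∑ (List⁺.toList all𝓡) (λ _ → ν)
    typical Pr≤ε = begin
      mean x                               ≡⟨ Pr[Z≡1]*length n n≤N ℓ 𝒢 A all𝓡 ⟨
      Pr[Z≡1] all𝓡 n n≤N ℓ 𝒢 A ℚ.* |all𝓡|  ≤⟨ *-monoʳ-≤ {|all𝓡|} (ℕ⇒ℚ-nonNeg (length all𝓡)) (bound (Pr≤1 (uniform all𝓡 >>= Z n n≤N ℓ 𝒢 A) _) Pr≤ε) ⟩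
      ν ℚ.* |all𝓡|                         ≡⟨ ℚ.*-comm ν |all𝓡| ⟩
      |all𝓡| ℚ.* ν                         ≡⟨ ∑-const (List⁺.toList all𝓡) ν ⟨
      ∑ (List⁺.toList all𝓡) (λ _ → ν)      ∎
      where
      open ℚ.≤-Reasoning
      |all𝓡| = ℕ⇒ℚ (length all𝓡)

    below-2ε : ∀ R → List⁺.toList R ≡ proj₁ sample → length R ≡ K →
      Pr[Z≡1] all𝓡 n n≤N ℓ 𝒢 A ℚ≤ ε′ → Pr[Z≡1] R n n≤N ℓ 𝒢 A ℚ< twice ε′
    -- Being below `twice ε′` means by definition that half the probability is below `ε′`; this
    -- explains `½` here and `¾ ν` in `Threshold`.
    below-2ε R R≡ |R|≡K Pr≤ε = Lower-ε-mono c-real 1≤c C c<C ½P≤¾ν ¾ν<ε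
      where
      open ℚ.≤-Reasoning
      Q = 11 ℕ.* bits
      P = Pr[Z≡1] R n n≤N ℓ 𝒢 A
      PK≤ : P ℚ.* ℕ⇒ℚ K ℚ.≤ ℕ⇒ℚ (3 ℕ.* (k ℕ.* Q))
      PK≤ = begin
        P ℚ.* ℕ⇒ℚ K                        ≡⟨ cong (λ m → P ℚ.* ℕ⇒ℚ m) |R|≡K ⟨
        P ℚ.* ℕ⇒ℚ (length R)               ≡⟨ Pr[Z≡1]*length n n≤N ℓ 𝒢 A R ⟩
        ∑ (List⁺.toList R) (failure x)     ≡⟨ cong (λ xs → ∑ xs (failure x)) R≡ ⟩
        ∑ (proj₁ sample) (failure x)       ≤⟨ proj₂ (proj₂ sample) (List.∈-filter⁺ typical? (∈-instances x) (typical Pr≤ε)) ⟩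
        ℕ⇒ℚ (3 ℕ.* (k ℕ.* Q))              ∎
      ½P≤¾ν : ½ ℚ.* P ℚ.≤ ¾ ℚ.* ν
      ½P≤¾ν = *-cancelʳ-≤ {ℕ⇒ℚ K} (ℕ⇒ℚ-mono-< {0} {K} (ℕ.<-≤-trans (ℕ.<⇒≤ 2≤N) N≤K)) (begin
        ½ ℚ.* P ℚ.* ℕ⇒ℚ K                          ≡⟨ ℚ.*-assoc ½ P (ℕ⇒ℚ K) ⟩
        ½ ℚ.* (P ℚ.* ℕ⇒ℚ K)                        ≤⟨ *-monoˡ-≤ (ℚ.nonNegative⁻¹ ½) PK≤ ⟩
        ½ ℚ.* ℕ⇒ℚ (3 ℕ.* (k ℕ.* Q))                ≡⟨ cong (½ ℚ.*_) (trans (ℕ⇒ℚ-* 3 (k ℕ.* Q)) (cong (ℕ⇒ℚ 3 ℚ.*_) (ℕ⇒ℚ-* k Q))) ⟩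
        ½ ℚ.* (ℕ⇒ℚ 3 ℚ.* (ℕ⇒ℚ k ℚ.* ℕ⇒ℚ Q))        ≡⟨ cong (λ m → ½ ℚ.* (ℕ⇒ℚ 3 ℚ.* (m ℚ.* ℕ⇒ℚ Q))) νL≡k ⟨
        ½ ℚ.* (ℕ⇒ℚ 3 ℚ.* (ν ℚ.* ℕ⇒ℚ L ℚ.* ℕ⇒ℚ Q))
          ≡⟨ solve 3 (λ ν L Q → con ½ :* (con (ℕ⇒ℚ 3) :* (ν :* L :* Q)) := con ¾ :* ν :* (L :* (con (ℕ⇒ℚ 2) :* Q))) refl ν (ℕ⇒ℚ L) (ℕ⇒ℚ Q) ⟩
        ¾ ℚ.* ν ℚ.* (ℕ⇒ℚ L ℚ.* (ℕ⇒ℚ 2 ℚ.* ℕ⇒ℚ Q))  ≡⟨ cong (¾ ℚ.* ν ℚ.*_) (trans (ℕ⇒ℚ-* L (2 ℕ.* Q)) (cong (ℕ⇒ℚ L ℚ.*_) (ℕ⇒ℚ-* 2 Q))) ⟨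
        ¾ ℚ.* ν ℚ.* ℕ⇒ℚ K                          ∎)

lemma5p5 :
    (c₀ : ℕ) → 1 ≤ c₀ →
    (tBC : ℕ → ℕ) → (∀ N → 2 ≤ N → 0 < tBC N) → QuadraticPolylog tBC →
    (rule : ∀ N → ProposalRule N) →
    (c : Cut) → IsReal c → 1ℚ ℚ≤ c →
    ∃[ a ] ∃[ b ] (IsReal a × 0ℚ ℚ< a × IsReal b × 0ℚ ℚ< b ×
      (∀ (N : ℕ) → .{{_ : NonTrivial N}} →
        let open SharedBit N c₀ (tBC N) (rule N)
            ε = N ^ʳ neg c
        in
        (∀ n → 2 ≤ n → (n≤N : n ≤ N) (ℓ : Fin (tBC N)) (𝒢 : DynamicGraph n) (A : Assignment n) →
          Pr[Z≡1] all𝓡 n n≤N ℓ 𝒢 A ℚ≤ ε) →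
        ∃[ R′ ]
          ((N ^ʳ a) ≤ℚ ℕ⇒ℚ (length R′) ×
           ℕ⇒ℚ (length R′) ℚ≤ (N ^ʳ b) ×
           (∀ n → 2 ≤ n → (n≤N : n ≤ N) (ℓ : Fin (tBC N)) (𝒢 : DynamicGraph n) (A : Assignment n) →
             Pr[Z≡1] R′ n n≤N ℓ 𝒢 A ℚ< twice ε))))
lemma5p5 c₀ _ tBC _ tBC-bounded rule c c-real 1≤c =
  -- The sample size `K` lies between `N` and `N^b`. The exponent `b` is uniform in `N`, as `C`
  -- comes from `c` alone and `e` from the growth of `tBC`.
  constant 1ℚ , constant (ℕ⇒ℚ b) , constant-isReal 1ℚ , 0<1 , constant-isReal (ℕ⇒ℚ b) , ℕ⇒ℚ-pos (7 ℕ.+ C ℕ.+ (2 ℕ.+ (e ℕ.+ (4 ℕ.+ c₀)))) , λ N hyp →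
    let open Sampling c₀ N (tBC N) (rule N) c-real 1≤c C c<C
        R , |R|≡K , _ = sample
        R′ , R′≡R = nonEmpty R (ℕ.<-≤-trans (ℕ.<⇒≤ 2≤N) (ℕ.≤-trans N≤K (ℕ.≤-reflexive (sym |R|≡K))))
        |R′|≡K = trans (cong List.length R′≡R) |R|≡K
    in R′
     , subst (λ m → (N ^ʳ constant 1ℚ) ≤ℚ ℕ⇒ℚ m) (sym |R′|≡K) (NegativePower.N^a≤ N N≤K)
     , subst (λ m → ℕ⇒ℚ m ℚ≤ (N ^ʳ constant (ℕ⇒ℚ b))) (sym |R′|≡K) (NegativePower.≤N^b N b (K≤ e (tBC≤ N 2≤N)))
     , λ n 2≤n n≤N ℓ 𝒢 A → below-2ε n n≤N ℓ 𝒢 A R′ R′≡R |R′|≡K (hyp n 2≤n n≤N ℓ 𝒢 A)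
  where
  C = proj₁ (natural-upper-bound c-real)
  c<C = proj₂ (natural-upper-bound c-real)
  e = proj₁ (polynomially-bounded tBC-bounded)
  tBC≤ = proj₂ (polynomially-bounded tBC-bounded)
  b = 8 ℕ.+ C ℕ.+ (2 ℕ.+ (e ℕ.+ (4 ℕ.+ c₀)))
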